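{- Let $G$ be a graph with minimum degree $\delta(G)\geq 2$ which is not a cycle, and let $G_1,\ldots,G_q$ be all the non-trivial blocks of $G$. (i) If $\mathrm{dim}(G_i)\leq 2c(G_i)-1$ for every $i$ such that $G_i$ is not a cycle, then $\mathrm{dim}(G)\leq 2c(G)-1$. (ii) If $\mathrm{edim}(G_i)\leq 2c(G_i)-1$ for every $i$ such that $G_i$ is not a cycle, then $\mathrm{edim}(G)\leq 2c(G)-1$.
   Context: All graphs are finite, simple and connected. The cyclomatic number is $c(H)=|E(H)|-|V(H)|+1$. A block of $G$ is a maximal $2$-connected subgraph (including bridges $K_2$); a block is non-trivial if it has at least three vertices. For vertices $u,v$, $d(u,v)$ is the length of a shortest $u$–$v$ path; for a vertex $u$ and an edge $e=vw$, $d(u,e)=\min\{d(u,v),d(u,w)\}$. A set $S\subseteq V(H)$ is a vertex (resp. edge) metric generator of $H$ if for every pair of distinct vertices (resp. edges) $x,x'$ of $H$ there is $s\in S$ with $d(s,x)\neq d(s,x')$. $\mathrm{dim}(H)$ (resp. $\mathrm{edim}(H)$) is the minimum size of a vertex (resp. edge) metric generator of $H$. -}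

module Defs where

open import Data.Nat using (ℕ; zero; suc; _+_; _*_; _≤_; _<ᵇ_; _⊓_)
open import Data.Nat.DivMod using (_%_)
open import Data.Integer as ℤ using (ℤ; +_)
open import Data.Fin using (Fin; toℕ; _≟_)
open import Data.Bool using (Bool; true; false; _∧_; not; if_then_else_)
open import Data.Bool.Properties using (∧-comm)
open import Data.Product using (Σ; ∃; ∃-syntax; _×_; _,_)
open import Data.Sum using (_⊎_)
open import Relation.Nullary using (¬_)
open import Relation.Nullary.Decidable using (⌊_⌋)
open import Relation.Binary.PropositionalEquality using (_≡_; _≢_; refl; cong₂)
open import Function.Bundles using (_⇔_)

record Graph (n : ℕ) : Set where
  field
    vert       : Fin n → Bool
    adj        : Fin n → Fin n → Bool
    adj-sym    : ∀ u v → adj u v ≡ adj v u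
    adj-irrefl : ∀ u → adj u u ≡ false
    adj-vert   : ∀ u v → adj u v ≡ true → vert u ≡ true
open Graph public

countB : ∀ {n} → (Fin n → Bool) → ℕ
countB {zero}  f = 0
countB {suc n} f = (if f Fin.zero then 1 else 0) + countB (λ i → f (Fin.suc i))
  where import Data.Fin as Fin

sumF : ∀ {n} → (Fin n → ℕ) → ℕ
sumF {zero}  f = 0
sumF {suc n} f = f Fin.zero + sumF (λ i → f (Fin.suc i))
  where import Data.Fin as Fin

∣V∣ : ∀ {n} → Graph n → ℕ
∣V∣ H = countB (vert H)

-- each edge {u,v} counted once, via the pair with toℕ u < toℕ v
∣E∣ : ∀ {n} → Graph n → ℕ
∣E∣ H = sumF (λ u → countB (λ v → adj H u v ∧ (toℕ u <ᵇ toℕ v)))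

deg : ∀ {n} → Graph n → Fin n → ℕ
deg H u = countB (adj H u)

cyc : ∀ {n} → Graph n → ℤ
cyc H = (+ ∣E∣ H) ℤ.- (+ ∣V∣ H) ℤ.+ (+ 1)

_⊆G_ : ∀ {n} → Graph n → Graph n → Set
H ⊆G K = (∀ u → vert H u ≡ true → vert K u ≡ true)
       × (∀ u v → adj H u v ≡ true → adj K u v ≡ true)

data Walk {n} (H : Graph n) : Fin n → Fin n → ℕ → Set where
  here : ∀ {u} → vert H u ≡ true → Walk H u u 0
  step : ∀ {u w v k} → adj H u w ≡ true → Walk H w v k → Walk H u v (suc k)

Connected : ∀ {n} → Graph n → Set
Connected H = ∀ u v → vert H u ≡ true → vert H v ≡ true → ∃[ k ] Walk H u v k

Dist : ∀ {n} → Graph n → Fin n → Fin n → ℕ → Set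
Dist H u v k = Walk H u v k × (∀ m → Walk H u v m → k ≤ m)

DistE : ∀ {n} → Graph n → Fin n → Fin n → Fin n → ℕ → Set
DistE H u v w k = ∃[ a ] ∃[ b ] (Dist H u v a × Dist H u w b × k ≡ a ⊓ b)

private
  ∧-true₁ : ∀ a b → a ∧ b ≡ true → a ≡ true
  ∧-true₁ true b p = refl

  ∧-swap : ∀ a b c → a ∧ (b ∧ c) ≡ a ∧ (c ∧ b)
  ∧-swap a b c = cong₂ _∧_ (refl {x = a}) (∧-comm b c)

delV : ∀ {n} → Graph n → Fin n → Graph n
delV {n} H x = record
  { vert = vert'
  ; adj = adj'
  ; adj-sym = λ u v → trans' u v
  ; adj-irrefl = λ u → irr u
  ; adj-vert = λ u v p → ∧-true₁ (vert' u) (vert' v) (proj₂' (adj H u v) _ p)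
  }
  where
  open import Relation.Binary.PropositionalEquality using (trans; sym)
  vert' : Fin n → Bool
  vert' u = vert H u ∧ not ⌊ u ≟ x ⌋
  adj' : Fin n → Fin n → Bool
  adj' u v = adj H u v ∧ (vert' u ∧ vert' v)
  trans' : ∀ u v → adj' u v ≡ adj' v u
  trans' u v = trans (∧-swap (adj H u v) (vert' u) (vert' v))
                     (cong₂ _∧_ (adj-sym H u v) refl)
  irr : ∀ u → adj' u u ≡ false
  irr u rewrite adj-irrefl H u = refl
  proj₂' : ∀ a b → a ∧ b ≡ true → b ≡ true
  proj₂' true b p = p

TwoConnected : ∀ {n} → Graph n → Set
TwoConnected H = (3 ≤ ∣V∣ H) × Connected H
               × (∀ x → vert H x ≡ true → Connected (delV H x))

-- H is a non-trivial block of G: a maximal 2-connected subgraph of G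
-- (blocks with at least three vertices are exactly these)
NontrivialBlock : ∀ {n} → Graph n → Graph n → Set
NontrivialBlock G H = H ⊆G G × TwoConnected H
  × (∀ K → H ⊆G K → K ⊆G G → TwoConnected K → K ⊆G H)

IsCycle : ∀ {n} → Graph n → Set
IsCycle {n} H = ∃[ k ] Σ (Fin (3 + k) → Fin n) λ f →
    (∀ i j → f i ≡ f j → i ≡ j)
  × (∀ i → vert H (f i) ≡ true)
  × (∀ u → vert H u ≡ true → ∃[ i ] f i ≡ u)
  × (∀ i j → (adj H (f i) (f j) ≡ true)
              ⇔ (toℕ j ≡ suc (toℕ i) % (3 + k) ⊎ toℕ i ≡ suc (toℕ j) % (3 + k)))

MinDegree≥2 : ∀ {n} → Graph n → Set
MinDegree≥2 H = ∀ u → vert H u ≡ true → 2 ≤ deg H u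

VertexMetricGenerator : ∀ {n} → Graph n → (Fin n → Bool) → Set
VertexMetricGenerator H S =
    (∀ s → S s ≡ true → vert H s ≡ true)
  × (∀ x x' → vert H x ≡ true → vert H x' ≡ true → x ≢ x' →
       ∃[ s ] (S s ≡ true × ∃[ a ] ∃[ b ] (Dist H s x a × Dist H s x' b × a ≢ b)))

EdgeMetricGenerator : ∀ {n} → Graph n → (Fin n → Bool) → Set
EdgeMetricGenerator H S =
    (∀ s → S s ≡ true → vert H s ≡ true)
  × (∀ v w v' w' → adj H v w ≡ true → adj H v' w' ≡ true →
       ¬ ((v ≡ v' × w ≡ w') ⊎ (v ≡ w' × w ≡ v')) →
       ∃[ s ] (S s ≡ true × ∃[ a ] ∃[ b ] (DistE H s v w a × DistE H s v' w' b × a ≢ b)))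

IsDim : ∀ {n} → Graph n → ℕ → Set
IsDim H d = (∃[ S ] (VertexMetricGenerator H S × countB S ≡ d))
          × (∀ S → VertexMetricGenerator H S → d ≤ countB S)

IsEdim : ∀ {n} → Graph n → ℕ → Set
IsEdim H d = (∃[ S ] (EdgeMetricGenerator H S × countB S ≡ d))
           × (∀ S → EdgeMetricGenerator H S → d ≤ countB S)

{-# OPTIONS --safe #-}
module Submission where

-- Write c for the cyclomatic number, and call an object o (vertex or edge) blocked at v if every landmark s on its side
-- of v has d(s,o) = d(s,v) + d(v,o). If v is a cut vertex and no object on one side is blocked, then any two objects on
-- different sides of v are distinguished, and seen from the other side the landmarks of this side do the work of v.
--
-- Every piece A hanging at a vertex v admits a set of at most 2c(A) landmarks that, together with v, distinguishes the
-- objects of A, and leaves none of them blocked at v. This goes by induction, splitting A at a cut vertex, c being additive.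
-- A cycle takes the two neighbours of v. A block with a generator S of size at most 2c − 1 needs one more landmark: the
-- objects blocked under S have distinct distances from v and lie on one geodesic, so its far end unblocks them all.
--
-- It remains to save one landmark. If G has a cut vertex, take a leaf block: there nothing has to be unblocked, so the
-- generator S suffices, or a single neighbour of the cut vertex if the leaf block is a cycle.
--
-- The inequality to be proved is decidable, so the argument is carried out under ¬¬ to allow classical reasoning.

open import Defs
open import Algebra.Properties.CommutativeSemigroup using (interchange)
open import Data.Bool using (Bool; true; false; _∧_; _∨_; not; if_then_else_)
open import Data.Bool.Properties using (∧-conicalˡ; ∧-conicalʳ; ∧-comm; ∨-zeroʳ)
open import Data.Empty using (⊥)
open import Data.Fin using (Fin; zero; suc; toℕ; _≟_)
open import Data.Fin.Properties using (toℕ-injective; suc-injective; toℕ<n; any?)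
import Data.Integer as ℤ
import Data.Integer.Properties as ℤ
import Data.Integer.Tactic.RingSolver as ℤ
open import Data.Nat using (ℕ; zero; suc; _+_; _*_; _≤_; _<_; z≤n; s≤s; _<ᵇ_; _∸_; _⊓_)
import Data.Nat as ℕ
open import Data.Nat.DivMod using (_%_; m<n⇒m%n≡m; n%n≡0)
open import Data.Nat.Properties hiding (_≟_; suc-injective)
open import Data.Nat.Tactic.RingSolver using (solve-∀)
open import Data.Product using (Σ; ∃-syntax; _×_; _,_; proj₁; proj₂)
open import Data.Sum using (_⊎_; inj₁; inj₂; [_,_]′)
open import Function using (_∘_)
open import Function.Bundles using (Equivalence; mk⇔)
open import Relation.Binary.Definitions using (tri<; tri≈; tri>)
open import Relation.Binary.PropositionalEquality hiding ([_])
open import Relation.Nullary using (¬_; Dec; yes; no; does; contradiction)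
open import Relation.Nullary.Decidable using (dec-true; decidable-stable; ⌊_⌋; ¬¬-excluded-middle; ¬?; _×-dec_; _⊎-dec_)

-- Double negation as a monad

infixl 1 _>>=_
_>>=_ : ∀ {a b} {A : Set a} {B : Set b} → ¬ ¬ A → (A → ¬ ¬ B) → ¬ ¬ B
(m >>= f) k = m (λ x → f x k)

return : ∀ {a} {A : Set a} → A → ¬ ¬ A
return x k = k x

em : ∀ {a} {P : Set a} → ¬ ¬ Dec P
em = ¬¬-excluded-middle

¬¬-finite-choice : ∀ {n} {P : Fin n → Set} → (∀ i → ¬ ¬ P i) → ¬ ¬ (∀ i → P i)
¬¬-finite-choice {zero}  h = return λ ()
¬¬-finite-choice {suc n} h = do
  p₀ ← h zero
  p ← ¬¬-finite-choice (h ∘ suc)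
  return λ { zero → p₀ ; (suc i) → p i }

-- Boolean subsets of `Fin n`

Sub : ℕ → Set
Sub n = Fin n → Bool

infix 4 _∈_ _∈?_ _⊆_
infixr 6 _∪_

-- Wrapped in a record so that `u` and `A` can be inferred from a membership proof; the bare
-- equation `A u ≡ true` would not determine them.
record _∈_ {n} (u : Fin n) (A : Sub n) : Set where
  constructor mem
  field true∈ : A u ≡ true
open _∈_ public

_∈?_ : ∀ {n} (u : Fin n) (A : Sub n) → Dec (u ∈ A)
u ∈? A with A u in eq
... | true  = yes (mem eq)
... | false = no λ p → contradiction (trans (sym eq) (true∈ p)) λ ()

_⊆_ : ∀ {n} → Sub n → Sub n → Set
A ⊆ B = ∀ {u} → u ∈ A → u ∈ B

_∪_ : ∀ {n} → Sub n → Sub n → Sub n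
(A ∪ B) u = A u ∨ B u

⟦_⟧ : ∀ {n} {P : Fin n → Set} → (∀ u → Dec (P u)) → Sub n
⟦ P? ⟧ u = does (P? u)

⁅_⁆ : ∀ {n} → Fin n → Sub n
⁅ x ⁆ = ⟦ _≟ x ⟧

∅ : ∀ {n} → Sub n
∅ _ = false

∧-intro : ∀ {a b} → a ≡ true → b ≡ true → a ∧ b ≡ true
∧-intro refl refl = refl

⟦⟧⁺ : ∀ {n} {P : Fin n → Set} (P? : ∀ u → Dec (P u)) {u} → P u → u ∈ ⟦ P? ⟧
⟦⟧⁺ P? {u} p = mem (dec-true (P? u) p)

⟦⟧⁻ : ∀ {n} {P : Fin n → Set} (P? : ∀ u → Dec (P u)) {u} → u ∈ ⟦ P? ⟧ → P u
⟦⟧⁻ P? {u} (mem e) with P? u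
... | yes p = p

∪⁺ˡ : ∀ {n} {A B : Sub n} → A ⊆ (A ∪ B)
∪⁺ˡ (mem p) = mem (cong (_∨ _) p)

∪⁺ʳ : ∀ {n} {A B : Sub n} → B ⊆ (A ∪ B)
∪⁺ʳ {A = A} (mem p) = mem (trans (cong (A _ ∨_) p) (∨-zeroʳ (A _)))

∪⁻ : ∀ {n} {A B : Sub n} {u} → u ∈ (A ∪ B) → u ∈ A ⊎ u ∈ B
∪⁻ {A = A} {u = u} (mem p) with A u in eq
... | true  = inj₁ (mem eq)
... | false = inj₂ (mem p)

∪-⊆ : ∀ {n} {A B C : Sub n} → A ⊆ C → B ⊆ C → (A ∪ B) ⊆ C
∪-⊆ a b p = [ a , b ]′ (∪⁻ p)

⁅⁆⁺ : ∀ {n} (x : Fin n) → x ∈ ⁅ x ⁆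
⁅⁆⁺ x = ⟦⟧⁺ (_≟ x) refl

⁅⁆⁻ : ∀ {n} {u x : Fin n} → u ∈ ⁅ x ⁆ → u ≡ x
⁅⁆⁻ {x = x} = ⟦⟧⁻ (_≟ x)

⁅⁆-⊆ : ∀ {n} {x : Fin n} {C : Sub n} → x ∈ C → ⁅ x ⁆ ⊆ C
⁅⁆-⊆ p q = subst (_∈ _) (sym (⁅⁆⁻ q)) p

-- Counting vertices and edges

b2n : Bool → ℕ
b2n b = if b then 1 else 0

countB≡sumF : ∀ {n} (A : Sub n) → countB A ≡ sumF (b2n ∘ A)
countB≡sumF {zero}  A = refl
countB≡sumF {suc n} A = cong (b2n (A zero) +_) (countB≡sumF (A ∘ suc))

sumF-cong : ∀ {n} {f g : Fin n → ℕ} → (∀ i → f i ≡ g i) → sumF f ≡ sumF g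
sumF-cong {zero}  h = refl
sumF-cong {suc n} h = cong₂ _+_ (h zero) (sumF-cong (h ∘ suc))

sumF-mono : ∀ {n} {f g : Fin n → ℕ} → (∀ i → f i ≤ g i) → sumF f ≤ sumF g
sumF-mono {zero}  h = z≤n
sumF-mono {suc n} h = +-mono-≤ (h zero) (sumF-mono (h ∘ suc))

sumF-+ : ∀ {n} (f g : Fin n → ℕ) → sumF (λ i → f i + g i) ≡ sumF f + sumF g
sumF-+ {zero}  f g = refl
sumF-+ {suc n} f g = trans (cong (f zero + g zero +_) (sumF-+ (f ∘ suc) (g ∘ suc)))
                           (interchange +-commutativeSemigroup (f zero) (g zero) _ _)

sumF-0 : ∀ {n} → sumF {n} (λ _ → 0) ≡ 0
sumF-0 {zero}  = refl
sumF-0 {suc n} = sumF-0 {n}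

sumF-swap : ∀ {m n} (f : Fin m → Fin n → ℕ) →
            sumF (λ i → sumF (f i)) ≡ sumF (λ j → sumF (λ i → f i j))
sumF-swap {zero}  {n} f = sym (sumF-0 {n})
sumF-swap {suc m} f = trans (cong (sumF (f zero) +_) (sumF-swap (f ∘ suc)))
                            (sym (sumF-+ (f zero) _))

≤-sumF : ∀ {n} (f : Fin n → ℕ) i → f i ≤ sumF f
≤-sumF f zero    = m≤m+n _ _
≤-sumF f (suc i) = ≤-trans (≤-sumF (f ∘ suc) i) (m≤n+m _ _)

countB-cong : ∀ {n} {A B : Sub n} → (∀ u → A u ≡ B u) → countB A ≡ countB B
countB-cong {A = A} {B} h =
  trans (countB≡sumF A) (trans (sumF-cong (cong b2n ∘ h)) (sym (countB≡sumF B)))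

sumF-countB : ∀ {n} (A B : Sub n) → sumF (λ u → b2n (A u) + b2n (B u)) ≡ countB A + countB B
sumF-countB A B = trans (sumF-+ (b2n ∘ A) (b2n ∘ B))
                        (sym (cong₂ _+_ (countB≡sumF A) (countB≡sumF B)))

b2n-∨ : ∀ a b → b2n (a ∨ b) ≤ b2n a + b2n b
b2n-∨ true  b = s≤s z≤n
b2n-∨ false b = ≤-refl

countB-∪ : ∀ {n} (A B : Sub n) → countB (A ∪ B) ≤ countB A + countB B
countB-∪ A B = ≤-trans (≤-reflexive (countB≡sumF (A ∪ B)))
  (≤-trans (sumF-mono (λ u → b2n-∨ (A u) (B u))) (≤-reflexive (sumF-countB A B)))

countB-∅ : ∀ {n} → countB {n} ∅ ≡ 0
countB-∅ {zero}  = refl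
countB-∅ {suc n} = countB-∅ {n}

countB-⁅⁆ : ∀ {n} (x : Fin n) → countB ⁅ x ⁆ ≡ 1
countB-⁅⁆ {suc n} zero    = cong suc (countB-∅ {n})
countB-⁅⁆ {suc n} (suc x) = countB-⁅⁆ x

b2n-mono : ∀ {a b} → (a ≡ true → b ≡ true) → b2n a ≤ b2n b
b2n-mono {false} h = z≤n
b2n-mono {true}  h rewrite h refl = ≤-refl

countB-mono : ∀ {n} {A B : Sub n} → A ⊆ B → countB A ≤ countB B
countB-mono {A = A} {B} h = subst₂ _≤_ (sym (countB≡sumF A)) (sym (countB≡sumF B))
  (sumF-mono (λ u → b2n-mono (λ p → true∈ (h {u} (mem p)))))

countB-disjoint : ∀ {n} {A B C : Sub n} → A ⊆ C → B ⊆ C → (∀ {u} → u ∈ A → ¬ u ∈ B) →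
                  countB A + countB B ≤ countB C
countB-disjoint {A = A} {B} {C} ac bc dis =
  subst₂ _≤_ (sumF-countB A B) (sym (countB≡sumF C)) (sumF-mono pw)
  where
  pw : ∀ u → b2n (A u) + b2n (B u) ≤ b2n (C u)
  pw u with A u in ea | B u in eb
  ... | true  | true  = contradiction (mem eb) (dis (mem ea))
  ... | true  | false rewrite true∈ (ac (mem ea)) = ≤-refl
  ... | false | true  rewrite true∈ (bc (mem eb)) = ≤-refl
  ... | false | false = z≤n

countB-< : ∀ {n} {A B : Sub n} {x} → A ⊆ B → x ∈ B → ¬ x ∈ A → countB A < countB B
countB-< {A = A} {B} {x} ab xb xa = subst (λ k → k + countB A ≤ countB B) (countB-⁅⁆ x)
  (countB-disjoint (⁅⁆-⊆ xb) ab (λ p q → xa (subst (_∈ A) (⁅⁆⁻ p) q)))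

countB-pair-≤ : ∀ {n} (v w : Fin n) → countB (⁅ v ⁆ ∪ ⁅ w ⁆) ≤ 2
countB-pair-≤ v w =
  ≤-trans (countB-∪ ⁅ v ⁆ ⁅ w ⁆) (≤-reflexive (cong₂ _+_ (countB-⁅⁆ v) (countB-⁅⁆ w)))

pair-≤-countB : ∀ {n} {A : Sub n} {x y} → x ∈ A → y ∈ A → x ≢ y → 2 ≤ countB A
pair-≤-countB {A = A} {x} {y} xa ya xy = subst (_≤ countB A) (cong₂ _+_ (countB-⁅⁆ x) (countB-⁅⁆ y))
  (countB-disjoint (⁅⁆-⊆ xa) (⁅⁆-⊆ ya) (λ p q → xy (trans (sym (⁅⁆⁻ p)) (⁅⁆⁻ q))))

triple-≤-countB : ∀ {n} {A : Sub n} {x y z} → x ∈ A → y ∈ A → z ∈ A →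
                  x ≢ y → x ≢ z → y ≢ z → 3 ≤ countB A
triple-≤-countB {A = A} {x} {y} {z} xa ya za xy xz yz = ≤-trans
  (s≤s (pair-≤-countB {A = ⁅ y ⁆ ∪ ⁅ z ⁆} (∪⁺ˡ (⁅⁆⁺ y)) (∪⁺ʳ (⁅⁆⁺ z)) yz))
  (countB-< (∪-⊆ (⁅⁆-⊆ ya) (⁅⁆-⊆ za)) xa (λ p → [ xy ∘ ⁅⁆⁻ , xz ∘ ⁅⁆⁻ ]′ (∪⁻ p)))

countB-pos : ∀ {n} {A : Sub n} → 1 ≤ countB A → ∃[ u ] u ∈ A
countB-pos {suc n} {A} h with A zero in eq
... | true  = zero , mem eq
... | false = let u , mem p = countB-pos h in suc u , mem p

countB-pair : ∀ {n} {A : Sub n} → 2 ≤ countB A → ∃[ u ] ∃[ v ] (u ∈ A × v ∈ A × u ≢ v)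
countB-pair {suc n} {A} h with A zero in eq
countB-pair {suc n} {A} (s≤s h) | true  = let v , mem p = countB-pos h in zero , suc v , mem eq , mem p , λ ()
countB-pair {suc n} {A} h       | false =
  let u , v , mem p , mem q , ne = countB-pair h in suc u , suc v , mem p , mem q , ne ∘ suc-injective

third : ∀ {n} {A : Sub n} → 3 ≤ countB A → ∀ v w → ¬ ¬ (∃[ u ] (u ∈ A × u ≢ v × u ≢ w))
third {A = A} h v w no₃ = contradiction (≤-trans h (≤-trans (countB-mono cover) (countB-pair-≤ v w))) λ { (s≤s (s≤s ())) }
  where
  cover : A ⊆ (⁅ v ⁆ ∪ ⁅ w ⁆)
  cover {u} p with u ≟ v | u ≟ w
  ... | yes refl | _        = ∪⁺ˡ (⁅⁆⁺ u)
  ... | no _     | yes refl = ∪⁺ʳ (⁅⁆⁺ u)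
  ... | no uv    | no uw    = contradiction (u , p , uv , uw) no₃

∣E∣-as-sum : ∀ {n} (H : Graph n) →
             ∣E∣ H ≡ sumF (λ u → sumF (λ v → b2n (adj H u v ∧ (toℕ u <ᵇ toℕ v))))
∣E∣-as-sum H = sumF-cong (λ u → countB≡sumF (λ v → adj H u v ∧ (toℕ u <ᵇ toℕ v)))

<⇒<ᵇ≡true : ∀ {m n} → m < n → (m <ᵇ n) ≡ true
<⇒<ᵇ≡true {zero}  (s≤s _) = refl
<⇒<ᵇ≡true {suc m} (s≤s p) = <⇒<ᵇ≡true p

-- With the ends ordered by `toℕ`, an adjacent ordered pair is counted by `up u v` or by `up v u`.
-- Exchanging the order of summation turns the second sum into the first, which is `∣E∣ H`.
handshake-≤ : ∀ {n} (H : Graph n) → sumF (deg H) ≤ ∣E∣ H + ∣E∣ H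
handshake-≤ H = begin
  sumF (deg H)                                       ≡⟨ sumF-cong (countB≡sumF ∘ adj H) ⟩
  sumF (λ u → sumF (λ v → b2n (adj H u v)))          ≤⟨ sumF-mono (λ u → sumF-mono (orient u)) ⟩
  sumF (λ u → sumF (λ v → up u v + up v u))          ≡⟨ sumF-cong (λ u → sumF-+ (up u) (λ v → up v u)) ⟩
  sumF (λ u → sumF (up u) + sumF (λ v → up v u))     ≡⟨ sumF-+ (λ u → sumF (up u)) _ ⟩
  sumF (λ u → sumF (up u)) + sumF (λ u → sumF (λ v → up v u))
    ≡⟨ cong (sumF (λ u → sumF (up u)) +_) (sumF-swap (λ u v → up v u)) ⟩
  sumF (λ u → sumF (up u)) + sumF (λ u → sumF (up u)) ≡⟨ sym (cong₂ _+_ (∣E∣-as-sum H) (∣E∣-as-sum H)) ⟩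
  ∣E∣ H + ∣E∣ H                                       ∎
  where
  open ≤-Reasoning
  up : _ → _ → ℕ
  up u v = b2n (adj H u v ∧ (toℕ u <ᵇ toℕ v))
  orient : ∀ u v → b2n (adj H u v) ≤ up u v + up v u
  orient u v with <-cmp (toℕ u) (toℕ v)
  ... | tri< u<v _ _ rewrite <⇒<ᵇ≡true u<v | ∧-comm (adj H u v) true = m≤m+n _ _
  ... | tri> _ _ v<u rewrite <⇒<ᵇ≡true v<u | ∧-comm (adj H v u) true | adj-sym H v u = m≤n+m _ _
  ... | tri≈ _ u≡v _ rewrite toℕ-injective u≡v | adj-irrefl H v = z≤n

-- With `c = 2` this gives |V| ≤ |E| for 2-connected pieces; with `c = 1` it serves for a single
-- edge.
min-degree⇒∣E∣ : ∀ {n} (H : Graph n) c → (∀ {u} → vert H u ≡ true → c ≤ deg H u) →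
                 c * ∣V∣ H ≤ ∣E∣ H + ∣E∣ H
min-degree⇒∣E∣ H c h = ≤-trans (≤-reflexive (trans (cong (c *_) (countB≡sumF (vert H))) (scale c (b2n ∘ vert H))))
  (≤-trans (sumF-mono pw) (handshake-≤ H))
  where
  scale : ∀ {n} c (f : Fin n → ℕ) → c * sumF f ≡ sumF (λ u → c * f u)
  scale {zero}  c f = *-zeroʳ c
  scale {suc n} c f = trans (*-distribˡ-+ c (f zero) _) (cong (c * f zero +_) (scale c (f ∘ suc)))
  pw : ∀ u → c * b2n (vert H u) ≤ deg H u
  pw u with vert H u in eq
  ... | true  = ≤-trans (≤-reflexive (*-identityʳ c)) (h eq)
  ... | false = ≤-trans (≤-reflexive (*-zeroʳ c)) z≤n

module _ {n} {H : Graph n} where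

  adj-vertʳ : ∀ {u v} → adj H u v ≡ true → v ∈ vert H
  adj-vertʳ {u} {v} p = mem (adj-vert H v u (trans (adj-sym H v u) p))

  adj⇒≢ : ∀ {u v} → adj H u v ≡ true → u ≢ v
  adj⇒≢ {u} p refl = contradiction (trans (sym p) (adj-irrefl H u)) λ ()

  adj-symm : ∀ {u v} → adj H u v ≡ true → adj H v u ≡ true
  adj-symm {u} {v} p = trans (adj-sym H v u) p

  walk-startᵛ : ∀ {u v k} → Walk H u v k → u ∈ vert H
  walk-startᵛ (here p)   = mem p
  walk-startᵛ (step p _) = mem (adj-vert H _ _ p)

  walk-endᵛ : ∀ {u v k} → Walk H u v k → v ∈ vert H
  walk-endᵛ (here p)   = mem p
  walk-endᵛ (step _ p) = walk-endᵛ p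

  walk-snoc : ∀ {u v w k} → Walk H u v k → adj H v w ≡ true → Walk H u w (suc k)
  walk-snoc (here _)   q = step q (here (true∈ (adj-vertʳ q)))
  walk-snoc (step p r) q = step p (walk-snoc r q)

  walk-sym : ∀ {u v k} → Walk H u v k → Walk H v u k
  walk-sym (here p)   = here p
  walk-sym (step p r) = walk-snoc (walk-sym r) (adj-symm p)

  walk-++ : ∀ {u v w j k} → Walk H u v j → Walk H v w k → Walk H u w (j + k)
  walk-++ (here _)   s = s
  walk-++ (step p r) s = step p (walk-++ r s)

  walk-0 : ∀ {u v} → Walk H u v 0 → u ≡ v
  walk-0 (here _) = refl

walk-mono : ∀ {n} {H K : Graph n} → H ⊆G K → ∀ {u v k} → Walk H u v k → Walk K u v k
walk-mono (hv , ha) (here p)   = here (hv _ p)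
walk-mono (hv , ha) (step p r) = step (ha _ _ p) (walk-mono (hv , ha) r)

-- Induced subgraphs and splittings at a cut vertex

-- The vertex set is `A` as it stands, so `vert (G [ A ])` reduces to `A`; the result is a subgraph
-- of `G` once `A ⊆ vert G`.
_[_] : ∀ {n} → Graph n → Sub n → Graph n
G [ A ] = record
  { vert       = A
  ; adj        = λ u v → adj G u v ∧ (A u ∧ A v)
  ; adj-sym    = λ u v → cong₂ _∧_ (adj-sym G u v) (∧-comm (A u) (A v))
  ; adj-irrefl = λ u → cong (_∧ (A u ∧ A u)) (adj-irrefl G u)
  ; adj-vert   = λ u v p → ∧-conicalˡ (A u) _ (∧-conicalʳ (adj G u v) _ p)
  }

record Edge {n} (G : Graph n) (A : Sub n) (u v : Fin n) : Set where
  constructor edge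
  field
    adjᵉ  : adj G u v ≡ true
    leftᵉ : u ∈ A
    rightᵉ : v ∈ A
open Edge public

module _ {n} {G : Graph n} {A : Sub n} where

  edge⁺ : ∀ {u v} → Edge G A u v → adj (G [ A ]) u v ≡ true
  edge⁺ (edge p a b) = ∧-intro p (∧-intro (true∈ a) (true∈ b))

  edge⁻ : ∀ {u v} → adj (G [ A ]) u v ≡ true → Edge G A u v
  edge⁻ {u} {v} p = edge (∧-conicalˡ (adj G u v) _ p) (mem (adj-vert (G [ A ]) u v p)) (adj-vertʳ {H = G [ A ]} p)

  edge-sym : ∀ {u v} → Edge G A u v → Edge G A v u
  edge-sym (edge p a b) = edge (adj-symm {H = G} p) b a

edge-mono : ∀ {n} {G : Graph n} {A B : Sub n} → A ⊆ B → ∀ {u v} → Edge G A u v → Edge G B u v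
edge-mono h (edge p a b) = edge p (h a) (h b)

induced-⊆G : ∀ {n} {G : Graph n} {A : Sub n} → A ⊆ vert G → (G [ A ]) ⊆G G
induced-⊆G {G = G} {A} h = (λ u p → true∈ (h (mem p))) , λ u v p → adjᵉ (edge⁻ {G = G} {A} p)

-- `far₁` and `far₂` make both sides strictly smaller than `A`, which drives the inductions.
record Split {n} (G : Graph n) (A A₁ A₂ : Sub n) (w : Fin n) : Set where
  field
    sub₁   : A₁ ⊆ A
    sub₂   : A₂ ⊆ A
    cover  : ∀ {u} → u ∈ A → u ∈ A₁ ⊎ u ∈ A₂
    cut₁   : w ∈ A₁
    cut₂   : w ∈ A₂
    meet   : ∀ {u} → u ∈ A₁ → u ∈ A₂ → u ≡ w
    noedge : ∀ {u v} → u ∈ A₁ → v ∈ A₂ → adj G u v ≡ true → u ≡ w ⊎ v ≡ w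
    far₁   : ∃[ p ] (p ∈ A₁ × p ≢ w)
    far₂   : ∃[ p ] (p ∈ A₂ × p ≢ w)

split-sym : ∀ {n} {G : Graph n} {A A₁ A₂ w} → Split G A A₁ A₂ w → Split G A A₂ A₁ w
split-sym {G = G} s = record
  { sub₁ = sub₂ ; sub₂ = sub₁ ; cover = [ inj₂ , inj₁ ]′ ∘ cover ; cut₁ = cut₂ ; cut₂ = cut₁
  ; meet = λ p q → meet q p
  ; noedge = λ p q e → [ inj₂ , inj₁ ]′ (noedge q p (adj-symm {H = G} e))
  ; far₁ = far₂ ; far₂ = far₁ }
  where open Split s

module _ {n} {G : Graph n} {A A₁ A₂ w} (s : Split G A A₁ A₂ w) where
  open Split s

  size₁ : countB A₁ < countB A
  size₁ = let p , p₂ , pw = far₂ in countB-< sub₁ (sub₂ p₂) (λ p₁ → pw (meet p₁ p₂))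

  -- Together with `split-∣E∣` this makes the cyclomatic number additive; the `1` is the cut vertex,
  -- counted on both sides.
  split-∣V∣ : countB A + 1 ≡ countB A₁ + countB A₂
  split-∣V∣ = begin
    countB A + 1           ≡⟨ cong (countB A +_) (sym (countB-⁅⁆ w)) ⟩
    countB A + countB ⁅ w ⁆ ≡⟨ sym (sumF-countB A ⁅ w ⁆) ⟩
    sumF (λ u → b2n (A u) + b2n (⁅ w ⁆ u)) ≡⟨ sumF-cong pw ⟩
    sumF (λ u → b2n (A₁ u) + b2n (A₂ u)) ≡⟨ sumF-countB A₁ A₂ ⟩
    countB A₁ + countB A₂  ∎
    where
    open ≡-Reasoning
    pw : ∀ u → b2n (A u) + b2n (⁅ w ⁆ u) ≡ b2n (A₁ u) + b2n (A₂ u)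
    pw u with u ≟ w
    ... | yes refl rewrite true∈ cut₁ | true∈ cut₂ | true∈ (sub₁ cut₁) = refl
    ... | no u≢w with A₁ u in e₁ | A₂ u in e₂ | A u in e
    ...   | true  | true  | _     = contradiction (meet (mem e₁) (mem e₂)) u≢w
    ...   | true  | false | true  = refl
    ...   | true  | false | false = contradiction (trans (sym e) (true∈ (sub₁ (mem e₁)))) λ ()
    ...   | false | true  | true  = refl
    ...   | false | true  | false = contradiction (trans (sym e) (true∈ (sub₂ (mem e₂)))) λ ()
    ...   | false | false | false = refl
    ...   | false | false | true with cover (mem e)
    ...     | inj₁ p = contradiction (trans (sym e₁) (true∈ p)) λ ()
    ...     | inj₂ p = contradiction (trans (sym e₂) (true∈ p)) λ ()

  edge-split : ∀ {u v} → Edge G A u v → Edge G A₁ u v ⊎ Edge G A₂ u v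
  edge-split (edge p a b) with cover a | cover b
  ... | inj₁ a₁ | inj₁ b₁ = inj₁ (edge p a₁ b₁)
  ... | inj₂ a₂ | inj₂ b₂ = inj₂ (edge p a₂ b₂)
  ... | inj₁ a₁ | inj₂ b₂ with noedge a₁ b₂ p
  ...   | inj₁ refl = inj₂ (edge p cut₂ b₂)
  ...   | inj₂ refl = inj₁ (edge p a₁ cut₁)
  edge-split (edge p a b) | inj₂ a₂ | inj₁ b₁ with noedge b₁ a₂ (adj-symm {H = G} p)
  ...   | inj₁ refl = inj₂ (edge p a₂ cut₂)
  ...   | inj₂ refl = inj₁ (edge p cut₁ b₁)

  edge-disjoint : ∀ {u v} → Edge G A₁ u v → ¬ Edge G A₂ u v
  edge-disjoint (edge p a b) (edge _ a′ b′) = adj⇒≢ {H = G} p (trans (meet a a′) (sym (meet b b′)))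

  split-∣E∣ : ∣E∣ (G [ A ]) ≡ ∣E∣ (G [ A₁ ]) + ∣E∣ (G [ A₂ ])
  split-∣E∣ = begin
    ∣E∣ (G [ A ])                                  ≡⟨ ∣E∣-as-sum (G [ A ]) ⟩
    sumF (λ u → sumF (λ v → up A u v))             ≡⟨ sumF-cong (λ u → sumF-cong (pw u)) ⟩
    sumF (λ u → sumF (λ v → up A₁ u v + up A₂ u v)) ≡⟨ sumF-cong (λ u → sumF-+ (up A₁ u) (up A₂ u)) ⟩
    sumF (λ u → sumF (up A₁ u) + sumF (up A₂ u))   ≡⟨ sumF-+ (λ u → sumF (up A₁ u)) _ ⟩
    sumF (λ u → sumF (up A₁ u)) + sumF (λ u → sumF (up A₂ u))
      ≡⟨ sym (cong₂ _+_ (∣E∣-as-sum (G [ A₁ ])) (∣E∣-as-sum (G [ A₂ ]))) ⟩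
    ∣E∣ (G [ A₁ ]) + ∣E∣ (G [ A₂ ])                ∎
    where
    open ≡-Reasoning
    up : Sub n → Fin n → Fin n → ℕ
    up B u v = b2n (adj (G [ B ]) u v ∧ (toℕ u <ᵇ toℕ v))
    pw : ∀ u v → up A u v ≡ up A₁ u v + up A₂ u v
    pw u v with adj (G [ A ]) u v in e | adj (G [ A₁ ]) u v in e₁ | adj (G [ A₂ ]) u v in e₂
    ... | _     | true  | true  = contradiction (edge⁻ e₂) (edge-disjoint (edge⁻ e₁))
    ... | true  | true  | false = sym (+-identityʳ _)
    ... | true  | false | true  = refl
    ... | false | false | false = refl
    ... | false | true  | false =
      contradiction (trans (sym e) (edge⁺ (edge-mono sub₁ (edge⁻ {G = G} {A₁} e₁)))) λ ()
    ... | false | false | true  =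
      contradiction (trans (sym e) (edge⁺ (edge-mono sub₂ (edge⁻ {G = G} {A₂} e₂)))) λ ()
    ... | true  | false | false with edge-split (edge⁻ {G = G} {A} e)
    ...   | inj₁ p = contradiction (trans (sym e₁) (edge⁺ p)) λ ()
    ...   | inj₂ p = contradiction (trans (sym e₂) (edge⁺ p)) λ ()

  -- An edge at a vertex of `A₁` other than `w` stays in `A₁`, so the walk can be followed inside
  -- `A₁` until it first meets `w`.
  walk-first-cut : ∀ {x y k} → x ∈ A₁ → Walk (G [ A ]) x y k →
    Walk (G [ A₁ ]) x y k
    ⊎ (∃[ i ] ∃[ j ] (i + j ≡ k × Walk (G [ A₁ ]) x w i × Walk (G [ A ]) w y j))
  walk-first-cut x₁ (here p) = inj₁ (here (true∈ x₁))
  walk-first-cut {x} x₁ (step p r) with x ≟ w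
  ... | yes refl = inj₂ (0 , _ , refl , here (true∈ x₁) , step p r)
  ... | no x≢w with edge-split (edge⁻ {G = G} {A} p)
  ...   | inj₂ e = contradiction (meet x₁ (leftᵉ e)) x≢w
  ...   | inj₁ e with walk-first-cut (rightᵉ e) r
  ...     | inj₁ q = inj₁ (step (edge⁺ e) q)
  ...     | inj₂ (i , j , eq , q , q′) = inj₂ (suc i , j , cong suc eq , step (edge⁺ e) q , q′)

  walk-through-cut : ∀ {x y k} → x ∈ A₁ → y ∈ A₂ → Walk (G [ A ]) x y k →
    ∃[ i ] ∃[ j ] (i + j ≡ k × Walk (G [ A₁ ]) x w i × Walk (G [ A ]) w y j)
  walk-through-cut {k = k} x₁ y₂ r with walk-first-cut x₁ r
  ... | inj₂ h = h
  -- A walk that never leaves `A₁` ends on both sides, hence at `w`, and the second part is empty.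
  ... | inj₁ q with meet (walk-endᵛ q) y₂
  ...   | refl = k , 0 , +-identityʳ k , q , here (true∈ (sub₁ cut₁))

  -- An excursion out of `A₁` leaves and returns through `w` and can be cut out. The return is found
  -- by reversing the rest of the walk. This is why the sides of a split are isometric.
  walk-shorten : ∀ {x y k} → x ∈ A₁ → y ∈ A₁ → Walk (G [ A ]) x y k →
                 ∃[ j ] (j ≤ k × Walk (G [ A₁ ]) x y j)
  walk-shorten {k = k} x₁ y₁ r with walk-first-cut x₁ r
  ... | inj₁ q = k , ≤-refl , q
  ... | inj₂ (i , j , eq , q , q′) with walk-through-cut y₁ cut₂ (walk-sym q′)
  ...   | i′ , j′ , eq′ , p , _ = i + i′ ,
    subst (i + i′ ≤_) eq (+-monoʳ-≤ i (subst (i′ ≤_) eq′ (m≤m+n i′ j′))) , walk-++ q (walk-sym p)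

-- If Q is a piece of A₁ not containing the old cut vertex, the rest of A₁ can be moved to the other side.
split-refine : ∀ {n} {G : Graph n} {A A₁ A₂ w P Q u} → Split G A A₁ A₂ w → Split G A₁ P Q u → w ∈ P →
               Split G A Q (P ∪ A₂) u
split-refine {G = G} {A₁ = A₁} {A₂} {w} {P} {Q} {u} s t w∈P = record
  { sub₁ = S.sub₁ ∘ T.sub₂
  ; sub₂ = ∪-⊆ (S.sub₁ ∘ T.sub₁) S.sub₂
  ; cover = λ a → [ (λ a₁ → [ inj₂ ∘ ∪⁺ˡ , inj₁ ]′ (T.cover a₁)) , inj₂ ∘ ∪⁺ʳ ]′ (S.cover a)
  ; cut₁ = T.cut₂
  ; cut₂ = ∪⁺ˡ T.cut₁
  ; meet = λ q r → [ (λ p → T.meet p q) , meet′ q ]′ (∪⁻ r)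
  ; noedge = λ q r e → [ (λ p → [ inj₂ , inj₁ ]′ (T.noedge p q (adj-symm {H = G} e))) , noedge′ q e ]′ (∪⁻ r)
  ; far₁ = T.far₂
  ; far₂ = let p , p∈ , ne = T.far₁ in p , ∪⁺ˡ p∈ , ne
  }
  where
  module S = Split s
  module T = Split t
  meet′ : ∀ {x} → x ∈ Q → x ∈ A₂ → x ≡ u
  meet′ q a₂ with S.meet (T.sub₂ q) a₂
  ... | refl = T.meet w∈P q
  noedge′ : ∀ {x y} → x ∈ Q → adj G x y ≡ true → y ∈ A₂ → x ≡ u ⊎ y ≡ u
  noedge′ q e a₂ with S.noedge (T.sub₂ q) a₂ e
  ... | inj₁ refl = inj₁ (T.meet w∈P q)
  ... | inj₂ refl = [ inj₂ , inj₁ ]′ (T.noedge w∈P q (adj-symm {H = G} e))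

-- Deleted vertices, degrees and 2-connectedness

module _ {n} {H : Graph n} {x : Fin n} where

  delV⁺ : ∀ {u} → u ∈ vert H → u ≢ x → u ∈ vert (delV H x)
  delV⁺ {u} (mem p) ne = mem (∧-intro p (differ (u ≟ x)))
    where
    differ : (d : Dec (u ≡ x)) → not ⌊ d ⌋ ≡ true
    differ (yes eq) = contradiction eq ne
    differ (no _)   = refl

  delV⁻ : ∀ {u} → u ∈ vert (delV H x) → u ∈ vert H × u ≢ x
  delV⁻ {u} (mem p) = mem (∧-conicalˡ (vert H u) _ p) , λ eq → same eq (u ≟ x) (∧-conicalʳ (vert H u) _ p)
    where
    same : u ≡ x → (d : Dec (u ≡ x)) → not ⌊ d ⌋ ≢ true
    same eq (yes _)  ()
    same eq (no ne)  _ = ne eq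

  delV-⊆G : delV H x ⊆G H
  delV-⊆G = (λ u p → true∈ (proj₁ (delV⁻ (mem p)))) , λ u v p → ∧-conicalˡ (adj H u v) _ p

  delV-adj⁺ : ∀ {u v} → adj H u v ≡ true → u ≢ x → v ≢ x → adj (delV H x) u v ≡ true
  delV-adj⁺ {u} {v} p ux vx =
    ∧-intro p (∧-intro (true∈ (delV⁺ (mem (adj-vert H u v p)) ux)) (true∈ (delV⁺ (adj-vertʳ {H = H} p) vx)))

TwoNeighbours : ∀ {n} → Graph n → Sub n → Fin n → Set
TwoNeighbours G A u = ∃[ a ] ∃[ b ] (Edge G A u a × Edge G A u b × a ≢ b)

-- Maximum degree at most 2, stated without counting.
Thin : ∀ {n} → Graph n → Sub n → Set
Thin G A = ∀ {x a b c} → Edge G A x a → Edge G A x b → Edge G A x c → a ≡ b ⊎ a ≡ c ⊎ b ≡ c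

⊆-pair⇒Thin : ∀ {n} {G : Graph n} {A : Sub n} {v w} → (∀ {u} → u ∈ A → u ≡ v ⊎ u ≡ w) → Thin G A
⊆-pair⇒Thin h e f g with h (rightᵉ e) | h (rightᵉ f) | h (rightᵉ g)
... | inj₁ p | inj₁ q | _      = inj₁ (trans p (sym q))
... | inj₂ p | inj₂ q | _      = inj₁ (trans p (sym q))
... | inj₁ p | inj₂ _ | inj₁ q = inj₂ (inj₁ (trans p (sym q)))
... | inj₂ p | inj₁ _ | inj₂ q = inj₂ (inj₁ (trans p (sym q)))
... | inj₁ _ | inj₂ p | inj₂ q = inj₂ (inj₂ (trans p (sym q)))
... | inj₂ _ | inj₁ p | inj₁ q = inj₂ (inj₂ (trans p (sym q)))

-- Gives the uniqueness of the predecessor of a vertex on a cycle.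
suc-%-injective : ∀ {k} {i j : Fin (suc k)} → suc (toℕ i) % suc k ≡ suc (toℕ j) % suc k → i ≡ j
suc-%-injective {k} {i} {j} eq with m≤n⇒m<n∨m≡n (toℕ<n i) | m≤n⇒m<n∨m≡n (toℕ<n j)
... | inj₁ p | inj₁ q = toℕ-injective (cong ℕ.pred
  (trans (sym (m<n⇒m%n≡m p)) (trans eq (m<n⇒m%n≡m q))))
... | inj₂ p | inj₂ q = toℕ-injective (cong ℕ.pred (trans p (sym q)))
... | inj₁ p | inj₂ q = contradiction
  (trans (sym (m<n⇒m%n≡m p)) (trans eq (trans (cong (_% suc k) q) (n%n≡0 (suc k))))) λ ()
... | inj₂ p | inj₁ q = contradiction
  (trans (sym (m<n⇒m%n≡m q)) (trans (sym eq) (trans (cong (_% suc k) p) (n%n≡0 (suc k))))) λ ()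

-- A neighbour of `f i` comes next or previous in the cyclic order, and each of these places holds
-- one vertex; of three neighbours two must share a place.
IsCycle⇒Thin : ∀ {n} {G : Graph n} {A : Sub n} → IsCycle (G [ A ]) → Thin G A
IsCycle⇒Thin {G = G} {A} (k , f , _ , _ , onto , nbrs) {x} ex ey ez
  with onto x (true∈ (leftᵉ ex)) | onto _ (true∈ (rightᵉ ex)) | onto _ (true∈ (rightᵉ ey)) | onto _ (true∈ (rightᵉ ez))
... | i , refl | a , refl | b , refl | c , refl = pigeonhole (side ex) (side ey) (side ez)
  where
  Next Prev : Fin (3 + k) → Set
  Next j = toℕ j ≡ suc (toℕ i) % (3 + k)
  Prev j = toℕ i ≡ suc (toℕ j) % (3 + k)
  side : ∀ {j} → Edge G A (f i) (f j) → Next j ⊎ Prev j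
  side {j} e = Equivalence.to (nbrs i j) (edge⁺ e)
  next : ∀ {j l} → Next j → Next l → f j ≡ f l
  next p q = cong f (toℕ-injective (trans p (sym q)))
  prev : ∀ {j l} → Prev j → Prev l → f j ≡ f l
  prev p q = cong f (suc-%-injective (trans (sym p) q))
  pigeonhole : ∀ {a b c} → Next a ⊎ Prev a → Next b ⊎ Prev b → Next c ⊎ Prev c →
               f a ≡ f b ⊎ f a ≡ f c ⊎ f b ≡ f c
  pigeonhole (inj₁ p) (inj₁ q) _        = inj₁ (next p q)
  pigeonhole (inj₂ p) (inj₂ q) _        = inj₁ (prev p q)
  pigeonhole (inj₁ p) (inj₂ _) (inj₁ q) = inj₂ (inj₁ (next p q))
  pigeonhole (inj₂ p) (inj₁ _) (inj₂ q) = inj₂ (inj₁ (prev p q))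
  pigeonhole (inj₁ _) (inj₂ p) (inj₂ q) = inj₂ (inj₂ (prev p q))
  pigeonhole (inj₂ _) (inj₁ p) (inj₁ q) = inj₂ (inj₂ (next p q))

module _ {n} {G : Graph n} {A : Sub n} where

  first-edge : ∀ {x y k} → x ≢ y → Walk (G [ A ]) x y k → ∃[ a ] Edge G A x a
  first-edge ne (here _)   = contradiction refl ne
  first-edge ne (step p _) = _ , edge⁻ p

  -- Once a neighbour `a` is deleted, `x` is still joined to some third vertex; the first edge of
  -- that walk leads to a neighbour other than `a`.
  TwoConnected⇒TwoNeighbours : TwoConnected (G [ A ]) → ∀ {x} → x ∈ A → ¬ ¬ TwoNeighbours G A x
  TwoConnected⇒TwoNeighbours (three , conn , rob) {x} xA = do
    y , yA , yx , _ ← third three x x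
    let a , e = first-edge (yx ∘ sym) (proj₂ (conn x y (true∈ xA) (true∈ yA)))
        ax = adj⇒≢ {H = G} (adjᵉ e)
    z , zA , zx , za ← third three x a
    let walk = proj₂ (rob a (true∈ (rightᵉ e)) x z
                       (true∈ (delV⁺ {H = G [ A ]} xA ax)) (true∈ (delV⁺ {H = G [ A ]} zA za)))
    return (second a e zx walk)
    where
    second : ∀ a → Edge G A x a → ∀ {z k} → z ≢ x → Walk (delV (G [ A ]) a) x z k → TwoNeighbours G A x
    second a e zx (here _)           = contradiction refl zx
    second a e zx (step {w = b} p r) =
      a , b , e , edge⁻ (proj₂ (delV-⊆G {H = G [ A ]}) _ _ p) ,
      (proj₂ (delV⁻ {H = G [ A ]} (walk-startᵛ r)) ∘ sym)

  -- In other words c(A) ≥ 1, which pays for the landmarks placed on a cycle.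
  TwoNeighbours⇒∣E∣ : (∀ {x} → x ∈ A → ¬ ¬ TwoNeighbours G A x) → ¬ ¬ (2 * countB A ≤ ∣E∣ (G [ A ]) + ∣E∣ (G [ A ]))
  TwoNeighbours⇒∣E∣ h = do
    nbrs ← ¬¬-finite-choice (λ u → choose u)
    return (min-degree⇒∣E∣ (G [ A ]) 2 (λ {u} p → deg≥2 (nbrs u (mem p))))
    where
    choose : ∀ u → ¬ ¬ (u ∈ A → TwoNeighbours G A u)
    choose u with u ∈? A
    ... | yes p = h p >>= λ t → return (λ _ → t)
    ... | no ¬p = return (λ p → contradiction p ¬p)
    deg≥2 : ∀ {u} → TwoNeighbours G A u → 2 ≤ deg (G [ A ]) u
    deg≥2 (a , b , ea , eb , ne) = pair-≤-countB (mem (edge⁺ ea)) (mem (edge⁺ eb)) ne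

module _ {n} {G : Graph n} {A : Sub n} (conn : Connected (G [ A ])) where

  private
    H = G [ A ]
    Reach : Fin n → Fin n → Fin n → Set
    Reach x y z = ∃[ k ] Walk (delV H x) y z k

    -- One side is `x` with the component of `y` in `A` minus `x`, the other is `x` with everything
    -- else, among it `z`.
    separate : ∀ {x y z} → (∀ u → Dec (Reach x y u)) → x ∈ A → y ∈ vert (delV H x) → z ∈ vert (delV H x) →
               ¬ Reach x y z → ∃[ A₁ ] ∃[ A₂ ] Split G A A₁ A₂ x
    separate {x} {y} {z} reach? xA yx zx ¬yz = ⟦ P₁? ⟧ , ⟦ P₂? ⟧ , record
      { sub₁ = λ p → [ (λ { refl → xA }) , (λ r → proj₁ (delV⁻ {H = H} (walk-endᵛ (proj₂ r)))) ]′ (⟦⟧⁻ P₁? p)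
      ; sub₂ = λ p → proj₁ (⟦⟧⁻ P₂? p)
      ; cover = cover
      ; cut₁ = ⟦⟧⁺ P₁? (inj₁ refl)
      ; cut₂ = ⟦⟧⁺ P₂? (xA , inj₁ refl)
      ; meet = λ p q → meet (⟦⟧⁻ P₁? p) (proj₂ (⟦⟧⁻ P₂? q))
      ; noedge = λ p q e → noedge e (⟦⟧⁻ P₁? p) (⟦⟧⁻ P₂? q)
      ; far₁ = y , ⟦⟧⁺ P₁? (inj₂ (0 , here (true∈ yx))) , proj₂ (delV⁻ {H = H} yx)
      ; far₂ = z , ⟦⟧⁺ P₂? (proj₁ (delV⁻ {H = H} zx) , inj₂ ¬yz) , proj₂ (delV⁻ {H = H} zx) }
      where
      P₁? : ∀ u → Dec (u ≡ x ⊎ Reach x y u)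
      P₁? u = u ≟ x ⊎-dec reach? u
      P₂? : ∀ u → Dec (u ∈ A × (u ≡ x ⊎ ¬ Reach x y u))
      P₂? u = u ∈? A ×-dec (u ≟ x ⊎-dec ¬? (reach? u))
      cover : ∀ {u} → u ∈ A → u ∈ ⟦ P₁? ⟧ ⊎ u ∈ ⟦ P₂? ⟧
      cover {u} p with reach? u
      ... | yes r = inj₁ (⟦⟧⁺ P₁? (inj₂ r))
      ... | no ¬r = inj₂ (⟦⟧⁺ P₂? (p , inj₂ ¬r))
      meet : ∀ {u} → u ≡ x ⊎ Reach x y u → u ≡ x ⊎ ¬ Reach x y u → u ≡ x
      meet (inj₁ p) _        = p
      meet (inj₂ r) (inj₁ p) = p
      meet (inj₂ r) (inj₂ q) = contradiction r q
      noedge : ∀ {u v} → adj G u v ≡ true → u ≡ x ⊎ Reach x y u → v ∈ A × (v ≡ x ⊎ ¬ Reach x y v) → u ≡ x ⊎ v ≡ x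
      noedge e (inj₁ p) _              = inj₁ p
      noedge e (inj₂ r) (_ , inj₁ p)   = inj₂ p
      noedge {u} {v} e (inj₂ (k , r)) (vA , inj₂ ¬r) with v ≟ x
      ... | yes p = inj₂ p
      ... | no vx =
        let uA , ux = delV⁻ {H = H} (walk-endᵛ r) in
        contradiction (suc k , walk-snoc r (delV-adj⁺ {H = H} (edge⁺ {G = G} (edge e uA vA)) ux vx)) ¬r

  TwoConnected⊎Split : 3 ≤ countB A →
    ¬ ¬ (TwoConnected H ⊎ (∃[ w ] ∃[ A₁ ] ∃[ A₂ ] Split G A A₁ A₂ w))
  TwoConnected⊎Split three = do
    -- The sides of a split are Boolean subsets, so reachability must be decided for all triples
    -- before a component can be carved out.
    reach? ← ¬¬-finite-choice λ x → ¬¬-finite-choice λ y → ¬¬-finite-choice λ z → em {P = Reach x y z}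
    no ¬bad ← em {P = ∃[ x ] ∃[ y ] ∃[ z ] (x ∈ A × y ∈ vert (delV H x) × z ∈ vert (delV H x) × ¬ Reach x y z)}
      where yes (x , y , z , xA , yx , zx , ¬r) →
              return (inj₂ (x , separate (reach? x y) xA yx zx ¬r))
    return (inj₁ (three , conn , λ x xA y z yx zx → join ¬bad (mem xA) (mem yx) (mem zx) (reach? x y z)))
    where
    join : ∀ {x y z} → ¬ _ → x ∈ A → y ∈ vert (delV H x) → z ∈ vert (delV H x) → Dec (Reach x y z) → Reach x y z
    join ¬bad xA yx zx (yes r) = r
    join ¬bad xA yx zx (no ¬r) = contradiction (_ , _ , _ , xA , yx , zx , ¬r) ¬bad

-- Isometric pieces of G

module Metric {n} (G : Graph n) (d : Fin n → Fin n → ℕ)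
              (dist : ∀ {u v} → u ∈ vert G → v ∈ vert G → Dist G u v (d u v)) where

  V : Sub n
  V = vert G

  d-≤ : ∀ {u v k} → Walk G u v k → d u v ≤ k
  d-≤ r = proj₂ (dist (walk-startᵛ r) (walk-endᵛ r)) _ r

  geodesic : ∀ {u v} → u ∈ V → v ∈ V → Walk G u v (d u v)
  geodesic u v = proj₁ (dist u v)

  d-refl : ∀ {u} → u ∈ V → d u u ≡ 0
  d-refl (mem u) = n≤0⇒n≡0 (d-≤ (here u))

  d≡0⇒≡ : ∀ {u v} → u ∈ V → v ∈ V → d u v ≡ 0 → u ≡ v
  d≡0⇒≡ u v eq = walk-0 (subst (Walk G _ _) eq (geodesic u v))

  d-sym : ∀ {u v} → u ∈ V → v ∈ V → d u v ≡ d v u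
  d-sym u v = ≤-antisym (d-≤ (walk-sym (geodesic v u))) (d-≤ (walk-sym (geodesic u v)))

  d-triangle : ∀ {u v w} → u ∈ V → v ∈ V → w ∈ V → d u w ≤ d u v + d v w
  d-triangle u v w = d-≤ (walk-++ (geodesic u v) (geodesic v w))

  d-adj : ∀ {u v} → adj G u v ≡ true → d u v ≤ 1
  d-adj {u} {v} e = d-≤ (step e (here (true∈ (adj-vertʳ {H = G} e))))

  d-pos : ∀ {u v} → u ∈ V → v ∈ V → u ≢ v → 0 < d u v
  d-pos u v ne = n≢0⇒n>0 (ne ∘ d≡0⇒≡ u v)

  -- The field closed is what makes a 2-connected G[A] a block of G.
  record Good (A : Sub n) : Set where
    field
      inV       : A ⊆ V
      isometric : ∀ {u v} → u ∈ A → v ∈ A → Walk (G [ A ]) u v (d u v)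
      closed    : ∀ K → K ⊆G G → TwoConnected K → ∀ {x y} → x ∈ vert K → y ∈ vert K → x ≢ y →
                  x ∈ A → y ∈ A → vert K ⊆ A

    connected : Connected (G [ A ])
    connected u v p q = d u v , isometric (mem p) (mem q)

    dist-induced : ∀ {u v} → u ∈ A → v ∈ A → Dist (G [ A ]) u v (d u v)
    dist-induced p q = isometric p q , λ m r → d-≤ (walk-mono (induced-⊆G {G = G} inV) r)

    dist-unique : ∀ {u v k} → Dist (G [ A ]) u v k → k ≡ d u v
    dist-unique (r , min) =
      ≤-antisym (min _ (isometric (walk-startᵛ r) (walk-endᵛ r))) (d-≤ (walk-mono (induced-⊆G {G = G} inV) r))

    -- A 2-connected `K` containing `G [ A ]` shares two vertices with `A`, so `closed` confines it
    -- to `A`; this is maximality.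
    block : TwoConnected (G [ A ]) → NontrivialBlock G (G [ A ])
    block tc = induced-⊆G {G = G} inV , tc , λ K A⊆K K⊆G tcK →
      let x , y , xA , yA , ne = countB-pair {A = A} (≤-trans (n≤1+n 2) (proj₁ tc))
          K⊆A = closed K K⊆G tcK (mem (proj₁ A⊆K x (true∈ xA))) (mem (proj₁ A⊆K y (true∈ yA))) ne xA yA
      in (λ u p → true∈ (K⊆A (mem p))) ,
         λ u v e → edge⁺ {G = G} (edge (proj₂ K⊆G u v e) (K⊆A (mem (adj-vert K u v e))) (K⊆A (adj-vertʳ {H = K} e)))

    step-towards : ∀ {u v k} → u ∈ A → v ∈ A → d u v ≡ suc k → ∃[ c ] (Edge G A u c × d c v ≡ k)
    step-towards {u} {v} {k} uA vA eq with subst (Walk (G [ A ]) u v) eq (isometric uA vA)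
    ... | step {w = c} p r = c , e ,
      ≤-antisym (d-≤ (walk-mono (induced-⊆G {G = G} inV) r))
                (+-cancelˡ-≤ 1 k _ (subst (_≤ 1 + d c v) eq
                  (≤-trans (d-triangle (inV uA) (inV (rightᵉ e)) (inV vA)) (+-monoˡ-≤ (d c v) (d-adj (adjᵉ e))))))
      where e = edge⁻ {G = G} {A} p

  open Good

  good-V : Connected G → Good V
  good-V conn = record
    { inV = λ p → p
    ; isometric = λ p q → walk-mono ((λ _ p → p) ,
        λ u v e → edge⁺ {G = G} (edge e (mem (adj-vert G u v e)) (adj-vertʳ {H = G} e))) (geodesic p q)
    ; closed = λ { K (kv , _) _ _ _ _ _ _ (mem p) → mem (kv _ p) } }

  module _ {A A₁ A₂ w} (g : Good A) (s : Split G A A₁ A₂ w) where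
    open Split s

    -- A geodesic from one side to the other passes through `w`, and neither of its parts is shorter
    -- than the corresponding distance.
    gate : ∀ {x y} → x ∈ A₁ → y ∈ A₂ → d x y ≡ d x w + d w y
    gate {x} {y} x₁ y₂ with walk-through-cut s x₁ y₂ (isometric g (sub₁ x₁) (sub₂ y₂))
    ... | i , j , eq , p , q = ≤-antisym
      (d-triangle (inV g (sub₁ x₁)) (inV g (sub₁ cut₁)) (inV g (sub₂ y₂)))
      (subst (d x w + d w y ≤_) eq (+-mono-≤
        (d-≤ (walk-mono (induced-⊆G {G = G} (inV g ∘ sub₁)) p))
        (d-≤ (walk-mono (induced-⊆G {G = G} (inV g)) q))))

    stay₁ : ∀ {K} → K ⊆G G → (∀ {u} → u ∈ vert K → u ∈ A × u ≢ w) →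
            ∀ {x u k} → x ∈ A₁ → Walk K x u k → u ∈ A₁
    stay₁ K⊆G h x₁ (here _) = x₁
    stay₁ {K} K⊆G h x₁ (step {u = x} {w = y} e r) with h (mem (adj-vert K x y e)) | h (walk-startᵛ r)
    ... | xA , xw | yA , yw with cover yA
    ...   | inj₁ y₁ = stay₁ K⊆G h y₁ r
    ...   | inj₂ y₂ = contradiction (noedge x₁ y₂ (proj₂ K⊆G x y e)) [ xw , yw ]′

    -- One of the two shared vertices differs from `w`. Since `K` stays connected without `w`, all
    -- its other vertices are reached from there without crossing the cut.
    closed₁ : ∀ K → K ⊆G G → TwoConnected K → ∀ {x y} → x ∈ vert K → y ∈ vert K → x ≢ y →
              x ∈ A₁ → y ∈ A₁ → vert K ⊆ A₁
    closed₁ K K⊆G tc@(_ , conn , rob) {x} {y} xK yK x≢y x₁ y₁ {u} uK = start (x ≟ w)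
      where
      K⊆A : vert K ⊆ A
      K⊆A = closed g K K⊆G tc xK yK x≢y (sub₁ x₁) (sub₁ y₁)
      from : ∀ {x} → x ∈ vert K → x ∈ A₁ → x ≢ w → u ∈ A₁
      from {x} xK x₁ xw with u ≟ w | w ∈? vert K
      ... | yes refl | _      = cut₁
      -- If `w` is in `K`, the walk is taken in `K` minus `w`; otherwise `K` itself avoids `w`.
      ... | no uw    | yes wK = stay₁ {delV K w}
        ((λ v p → proj₁ K⊆G v (true∈ (proj₁ (delV⁻ {H = K} (mem p))))) ,
         (λ a b p → proj₂ K⊆G a b (proj₂ (delV-⊆G {H = K} {w}) a b p)))
        (λ p → let q , ne = delV⁻ {H = K} p in K⊆A q , ne)
        x₁ (proj₂ (rob w (true∈ wK) x u (true∈ (delV⁺ {H = K} xK xw)) (true∈ (delV⁺ {H = K} uK uw))))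
      ... | no uw    | no ¬wK =
        stay₁ K⊆G (λ p → K⊆A p , λ { refl → ¬wK p }) x₁ (proj₂ (conn x u (true∈ xK) (true∈ uK)))
      start : Dec (x ≡ w) → u ∈ A₁
      start (no xw)    = from xK x₁ xw
      start (yes refl) = from yK y₁ (x≢y ∘ sym)

    good₁ : Good A₁
    good₁ = record
      { inV = inV g ∘ sub₁
      ; isometric = λ {u} {v} p q →
          let j , j≤ , r = walk-shorten s p q (isometric g (sub₁ p) (sub₁ q))
          in subst (Walk (G [ A₁ ]) u v)
               (≤-antisym j≤ (d-≤ (walk-mono (induced-⊆G {G = G} (inV g ∘ sub₁)) r))) r
      ; closed = closed₁ }

    two-neighbours₁ : ∀ {u} → u ∈ A₁ → u ≢ w → TwoNeighbours G A u → TwoNeighbours G A₁ u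
    two-neighbours₁ {u} u₁ uw (a , b , ea , eb , ne) = a , b , in₁ ea , in₁ eb , ne
      where
      in₁ : ∀ {a} → Edge G A u a → Edge G A₁ u a
      in₁ e = [ (λ p → p) , (λ e₂ → contradiction (meet u₁ (leftᵉ e₂)) uw) ]′ (edge-split s e)

-- Sizes of landmark sets

-- Since c = e - a + 1, the bound `s + 2 * a ≤ 2 * e + k` reads s ≤ 2c - 2 + k: `k = 2` means at
-- most 2c landmarks, `k = 1` at most 2c - 1. The extra 2 from the second piece is absorbed by the
-- doubly counted cut vertex.
size-glue : ∀ {k s s₁ s₂ a a₁ a₂ e e₁ e₂} → s ≤ s₁ + s₂ →
            s₁ + 2 * a₁ ≤ 2 * e₁ + k → s₂ + 2 * a₂ ≤ 2 * e₂ + 2 →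
            a + 1 ≡ a₁ + a₂ → e ≡ e₁ + e₂ → s + 2 * a ≤ 2 * e + k
size-glue {k} {s} {s₁} {s₂} {a} {a₁} {a₂} {e} {e₁} {e₂} h h₁ h₂ ha refl = +-cancelʳ-≤ 2 _ _ (begin
  s + 2 * a + 2                   ≡⟨ lhs s a ⟩
  s + 2 * (a + 1)                 ≡⟨ cong (λ x → s + 2 * x) ha ⟩
  s + 2 * (a₁ + a₂)               ≤⟨ +-monoˡ-≤ _ h ⟩
  s₁ + s₂ + 2 * (a₁ + a₂)         ≡⟨ mid s₁ s₂ a₁ a₂ ⟩
  s₁ + 2 * a₁ + (s₂ + 2 * a₂)     ≤⟨ +-mono-≤ h₁ h₂ ⟩
  2 * e₁ + k + (2 * e₂ + 2)       ≡⟨ rhs e₁ e₂ k ⟩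
  2 * (e₁ + e₂) + k + 2           ∎)
  where
  open ≤-Reasoning
  lhs : ∀ s a → s + 2 * a + 2 ≡ s + 2 * (a + 1)
  lhs = solve-∀
  mid : ∀ s₁ s₂ a₁ a₂ → s₁ + s₂ + 2 * (a₁ + a₂) ≡ s₁ + 2 * a₁ + (s₂ + 2 * a₂)
  mid = solve-∀
  rhs : ∀ e₁ e₂ k → 2 * e₁ + k + (2 * e₂ + 2) ≡ 2 * (e₁ + e₂) + k + 2
  rhs = solve-∀

split-size : ∀ {n} {G : Graph n} {A A₁ A₂ w} → Split G A A₁ A₂ w → ∀ k (S₁ S₂ : Sub n) →
             countB S₁ + 2 * countB A₁ ≤ 2 * ∣E∣ (G [ A₁ ]) + k →
             countB S₂ + 2 * countB A₂ ≤ 2 * ∣E∣ (G [ A₂ ]) + 2 →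
             countB (S₁ ∪ S₂) + 2 * countB A ≤ 2 * ∣E∣ (G [ A ]) + k
split-size {G = G} {A} {A₁} {A₂} s k S₁ S₂ h₁ h₂ =
  size-glue {k} {countB (S₁ ∪ S₂)} {countB S₁} {countB S₂} {countB A} {countB A₁} {countB A₂}
            {∣E∣ (G [ A ])} {∣E∣ (G [ A₁ ])} {∣E∣ (G [ A₂ ])}
            (countB-∪ S₁ S₂) h₁ h₂ (split-∣V∣ s) (split-∣E∣ s)

-- Glueing sets of landmarks

module Landmarks {n} (G : Graph n) (d : Fin n → Fin n → ℕ)
                 (dist : ∀ {u v} → u ∈ vert G → v ∈ vert G → Dist G u v (d u v)) where

  open Metric G d dist

  -- The objects to be distinguished are the vertices for dim and the edges for edim. Triv v o means that o is the
  -- vertex v: such an object lies in every piece containing v.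
  record Objects : Set₁ where
    infix 4 _~_
    field
      Obj    : Set
      _~_    : Obj → Obj → Set
      In     : Sub n → Obj → Set
      δ      : Fin n → Obj → ℕ
      Triv   : Fin n → Obj → Set
      triv?  : ∀ v o → Dec (Triv v o)
      δ-resp : ∀ {o o′} → o ~ o′ → ∀ s → δ s o ≡ δ s o′
      δ-triangle : ∀ {A s t o} → Good A → s ∈ A → t ∈ A → In A o → δ s o ≤ d s t + δ t o
      δ-bounded  : ∀ v → ∃[ N ] (∀ o → δ v o ≤ N)
      In-mono  : ∀ {A B o} → A ⊆ B → In A o → In B o
      In-split : ∀ {A A₁ A₂ w o} → Split G A A₁ A₂ w → In A o → In A₁ o ⊎ In A₂ o
      Triv-in  : ∀ {A w o} → w ∈ A → Triv w o → In A o
      δ-gate   : ∀ {A A₁ A₂ w s o} → Good A → Split G A A₁ A₂ w → s ∈ A₁ → In A₂ o → δ s o ≡ d s w + δ w o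
      inhabited  : ∀ {A o} → In A o → ∃[ u ] u ∈ A
      nontrivial : ∀ {A w q} → Good A → w ∈ A → q ∈ A → q ≢ w → ∃[ o ] (In A o × ¬ Triv w o)
      two-objects : ∀ {A v} → TwoNeighbours G A v → ∃[ o ] ∃[ o′ ] (In A o × In A o′ × ¬ o ~ o′)
      -- Ensures that the neighbours of `v` together leave nothing blocked at `v`.
      neighbour : ∀ {A v o} → Good A → v ∈ A → In A o → ¬ Triv v o →
                  ∃[ s ] (Edge G A v s × δ s o < d s v + δ v o)
      -- With degrees at most 2, an object is determined by its distance from `v` and the direction
      -- in which it lies, and one neighbour of `v` reveals the direction.
      thin : ∀ {A v a o o′} → Good A → Thin G A → Edge G A v a → In A o → In A o′ →
             δ v o ≡ δ v o′ → δ a o ≡ δ a o′ → o ~ o′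
      -- The o″ are the objects on a geodesic from v to o, and t is the end of that geodesic.
      chain : ∀ {A v o} → Good A → v ∈ A → In A o → ¬ Triv v o →
              ∃[ t ] (t ∈ A × (∀ {o′} → In A o′ → ¬ Triv v o′ → δ v o′ ≤ δ v o →
                ∃[ o″ ] (In A o″ × δ v o″ ≡ δ v o′
                         × (∀ {s} → s ∈ A → δ s o ≡ d s v + δ v o → δ s o″ ≡ d s v + δ v o″)
                         × δ t o″ < d t v + δ v o″)))

    Resolves : (Fin n → Set) → Sub n → Set
    Resolves P A = ∀ {o o′} → In A o → In A o′ → ¬ o ~ o′ → ∃[ s ] (P s × δ s o ≢ δ s o′)

    Unblocked : (Fin n → Set) → Fin n → Sub n → Set
    Unblocked P v A = ∀ {o} → In A o → ¬ Triv v o → ∃[ s ] (P s × δ s o < d s v + δ v o)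

    field
      IsGenerator : Graph n → Sub n → Set
      generator⇒resolves : ∀ {A S} → Good A → IsGenerator (G [ A ]) S → S ⊆ A × Resolves (_∈ S) A
      full-generator     : ∀ {A} → Good A → IsGenerator (G [ A ]) A
      resolves⇒generator : ∀ {S} → Good V → S ⊆ V → Resolves (_∈ S) V → IsGenerator G S

  module _ (𝒪 : Objects) where
    open Objects 𝒪

    -- W marks the vertices at which parts of G containing further landmarks are attached to A; seen from A,
    -- such a landmark is as good as the vertex itself.
    Landmark : Sub n → Sub n → Sub n → Fin n → Set
    Landmark A S W s = s ∈ S ⊎ (s ∈ A × s ∈ W)

    -- `size` says |S| ≤ 2c(A). The root stands for landmarks outside `A` that see `A` through `v`;
    -- they help to resolve, but leave every object of `A` blocked at `v`, so `unblocked` has to do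
    -- without the root.
    record Rooted (A : Sub n) (v : Fin n) (W : Sub n) : Set where
      field
        S         : Sub n
        S⊆A       : S ⊆ A
        size      : countB S + 2 * countB A ≤ 2 * ∣E∣ (G [ A ]) + 2
        resolves  : Resolves (λ s → Landmark A S W s ⊎ s ≡ v) A
        unblocked : Unblocked (Landmark A S W) v A

    module _ {A A₁ A₂ w} (g : Good A) (s : Split G A A₁ A₂ w) where
      open Split s

      gate₁ : ∀ {t o} → t ∈ A₁ → In A₂ o → δ t o ≡ d t w + δ w o
      gate₁ = δ-gate g s

      gate₂ : ∀ {t o} → t ∈ A₂ → In A₁ o → δ t o ≡ d t w + δ w o
      gate₂ = δ-gate g (split-sym s)

      -- If `t` fails, then `o` is at least as far from `w` as `o′`, because the route from `t` to
      -- `o′` passes `w`. If `x` fails, then `o` is strictly nearer to `w`, because `x` has a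
      -- shortcut to `o′`. Both cannot happen.
      separated-across : ∀ {t x o o′} → t ∈ A₁ → x ∈ A₂ → In A₁ o → In A₂ o′ → δ x o′ < d x w + δ w o′ →
                         δ t o ≢ δ t o′ ⊎ δ x o ≢ δ x o′
      separated-across {t} {x} {o} {o′} t₁ x₂ o₁ o₂ x<  with δ t o ℕ.≟ δ t o′
      ... | no ne  = inj₁ ne
      ... | yes eq = inj₂ λ eq′ → <-irrefl eq (begin-strict
        δ t o           ≤⟨ δ-triangle g (sub₁ t₁) (sub₁ cut₁) (In-mono sub₁ o₁) ⟩
        d t w + δ w o   <⟨ +-monoʳ-< (d t w) (+-cancelˡ-< (d x w) _ _
                              (subst (_< d x w + δ w o′) (trans (sym eq′) (gate₂ x₂ o₁)) x<)) ⟩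
        d t w + δ w o′  ≡⟨ sym (gate₁ t₁ o₂) ⟩
        δ t o′          ∎)
        where open ≤-Reasoning

      -- From `t` the objects of `A₂` are seen through `w`, all with the same offset `d t w`.
      transfer₁ : ∀ {t o o′} → t ∈ A₁ → In A₂ o → In A₂ o′ → δ w o ≢ δ w o′ → δ t o ≢ δ t o′
      transfer₁ {t} t₁ o₂ o₂′ ne eq = ne (+-cancelˡ-≡ (d t w) _ _
        (trans (sym (gate₁ t₁ o₂)) (trans eq (gate₁ t₁ o₂′))))

      -- Objects on different sides are told apart by some landmark in `A₁` and one unblocking the
      -- object of `A₂`. If that object is the vertex `w`, it lies in `A₁` as well. Unblocking is
      -- asked of `A₂` alone, which lets a leaf block take the place of `A₁`.
      resolves-glue : ∀ {P : Fin n → Set} →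
        (∀ {o o′} → In A₁ o → In A₁ o′ → ¬ o ~ o′ → ∃[ t ] (P t × δ t o ≢ δ t o′)) →
        (∀ {o o′} → In A₂ o → In A₂ o′ → ¬ o ~ o′ → ∃[ t ] (P t × δ t o ≢ δ t o′)) →
        (∃[ t ] (P t × t ∈ A₁)) → Unblocked (λ x → P x × x ∈ A₂) w A₂ → Resolves P A
      resolves-glue {P} both₁ both₂ (t , Pt , t₁) ub {o} {o′} i i′ ne with In-split s i | In-split s i′
      ... | inj₁ i₁ | inj₁ i₁′ = both₁ i₁ i₁′ ne
      ... | inj₂ i₂ | inj₂ i₂′ = both₂ i₂ i₂′ ne
      ... | inj₁ i₁ | inj₂ i₂′ with triv? w o′
      ...   | yes tr = both₁ i₁ (Triv-in cut₁ tr) ne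
      ...   | no ¬tr with ub i₂′ ¬tr
      ...     | x , (Px , x₂) , x< = [ (λ h → t , Pt , h) , (λ h → x , Px , h) ]′ (separated-across t₁ x₂ i₁ i₂′ x<)
      resolves-glue {P} both₁ both₂ (t , Pt , t₁) ub {o} {o′} i i′ ne | inj₂ i₂ | inj₁ i₁′ with triv? w o
      ...   | yes tr = both₁ (Triv-in cut₁ tr) i₁′ ne
      ...   | no ¬tr with ub i₂ ¬tr
      ...     | x , (Px , x₂) , x< =
        [ (λ h → t , Pt , h ∘ sym) , (λ h → x , Px , h ∘ sym) ]′ (separated-across t₁ x₂ i₁′ i₂ x<)

    -- Seen from `A₁`, the landmarks of `A₂` act as `w`, so `w` is added to the marked vertices;
    -- seen from `A₂`, the root `v` acts as `w`, so `A₂` is rooted there.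
    rooted-glue : ∀ {A A₁ A₂ v w W} → Good A → Split G A A₁ A₂ w → v ∈ A₁ →
                  Rooted A₁ v (W ∪ ⁅ w ⁆) → Rooted A₂ w W → Rooted A v W
    rooted-glue {A} {A₁} {A₂} {v} {w} {W} g s v₁ r₁ r₂ = record
      { S = R₁.S ∪ R₂.S
      ; S⊆A = ∪-⊆ (sub₁ ∘ R₁.S⊆A) (sub₂ ∘ R₂.S⊆A)
      ; size = split-size s 2 R₁.S R₂.S R₁.size R₂.size
      ; resolves = resolves-glue g s both₁ both₂ (v , inj₂ refl , v₁) ub₂
      ; unblocked = unblocked
      }
      where
      open Split s
      module R₁ = Rooted r₁
      module R₂ = Rooted r₂
      L : Fin n → Set
      L = Landmark A (R₁.S ∪ R₂.S) W

      from₁ : ∀ {t} → Landmark A₁ R₁.S (W ∪ ⁅ w ⁆) t → (L t × t ∈ A₁) ⊎ t ≡ w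
      from₁ (inj₁ p) = inj₁ (inj₁ (∪⁺ˡ p) , R₁.S⊆A p)
      from₁ (inj₂ (p , q)) = [ (λ r → inj₁ (inj₂ (sub₁ p , r) , p)) , inj₂ ∘ ⁅⁆⁻ ]′ (∪⁻ q)

      from₂ : ∀ {t} → Landmark A₂ R₂.S W t → L t × t ∈ A₂
      from₂ (inj₁ p)       = inj₁ (∪⁺ʳ p) , R₂.S⊆A p
      from₂ (inj₂ (p , q)) = inj₂ (sub₂ p , q) , p

      beyond : ∃[ t ] (L t × t ∈ A₂)
      -- An object of `A₂` other than `w` is unblocked by a landmark, which therefore exists beyond
      -- `w`.
      beyond = let q , q₂ , qw = far₂
                   o , i , ¬tr = nontrivial (good₁ g (split-sym s)) cut₂ q₂ qw
                   t , l , _ = R₂.unblocked i ¬tr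
               in t , from₂ l

      ub₂ : Unblocked (λ x → (L x ⊎ x ≡ v) × x ∈ A₂) w A₂
      ub₂ i ¬tr = let x , l , x< = R₂.unblocked i ¬tr
                      l′ , x₂ = from₂ l
                  in x , (inj₁ l′ , x₂) , x<

      both₁ : ∀ {o o′} → In A₁ o → In A₁ o′ → ¬ o ~ o′ → ∃[ t ] ((L t ⊎ t ≡ v) × δ t o ≢ δ t o′)
      both₁ i i′ ne with R₁.resolves i i′ ne
      ... | t , inj₂ t≡v , h = t , inj₂ t≡v , h
      ... | t , inj₁ l , h with from₁ l
      ...   | inj₁ (l′ , _) = t , inj₁ l′ , h
      ...   | inj₂ refl = let b , lb , b₂ = beyond in b , inj₁ lb , transfer₁ g (split-sym s) b₂ i i′ h

      both₂ : ∀ {o o′} → In A₂ o → In A₂ o′ → ¬ o ~ o′ → ∃[ t ] ((L t ⊎ t ≡ v) × δ t o ≢ δ t o′)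
      both₂ i i′ ne with R₂.resolves i i′ ne
      ... | t , inj₁ l , h    = t , inj₁ (proj₁ (from₂ l)) , h
      ... | t , inj₂ refl , h = v , inj₂ refl , transfer₁ g s v₁ i i′ h

      open ≤-Reasoning

      unblocked₁ : ∀ {o} → In A₁ o → ¬ Triv v o → ∃[ t ] (L t × δ t o < d t v + δ v o)
      unblocked₁ {o} i ¬tr with R₁.unblocked i ¬tr
      ... | t , l , t< with from₁ l
      ...   | inj₁ (l′ , _) = t , l′ , t<
      -- The marked vertex `w` unblocks `o`; a landmark beyond it does the same, with `d b w` added
      -- on both sides.
      ...   | inj₂ refl = let b , lb , b₂ = beyond in b , lb , (begin-strict
        δ b o                     ≡⟨ gate₂ g s b₂ i ⟩
        d b w + δ w o             <⟨ +-monoʳ-< (d b w) t< ⟩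
        d b w + (d w v + δ v o)   ≡⟨ sym (+-assoc (d b w) _ _) ⟩
        d b w + d w v + δ v o     ≡⟨ cong (_+ δ v o) (sym (gate g (split-sym s) b₂ v₁)) ⟩
        d b v + δ v o             ∎)

      -- A detour through `w` is strict already, and the route through `v` also passes `w`, so it is
      -- no shorter.
      unblocked₂ : ∀ {o} → In A₂ o → ¬ Triv w o → ∃[ t ] (L t × δ t o < d t v + δ v o)
      unblocked₂ {o} i ¬tr with R₂.unblocked i ¬tr
      ... | t , l , t< = let l′ , t₂ = from₂ l in t , l′ , (begin-strict
        δ t o                     <⟨ t< ⟩
        d t w + δ w o             ≤⟨ +-monoʳ-≤ (d t w) (δ-triangle g (sub₁ cut₁) (sub₁ v₁) (In-mono sub₂ i)) ⟩
        d t w + (d w v + δ v o)   ≡⟨ sym (+-assoc (d t w) _ _) ⟩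
        d t w + d w v + δ v o     ≡⟨ cong (_+ δ v o) (sym (gate g (split-sym s) t₂ v₁)) ⟩
        d t v + δ v o             ∎)

      unblocked : Unblocked L v A
      unblocked {o} i ¬tr with In-split s i
      ... | inj₁ i₁ = unblocked₁ i₁ ¬tr
      ... | inj₂ i₂ with triv? w o
      ...   | yes tr = unblocked₁ (Triv-in cut₁ tr) ¬tr
      ...   | no ¬trw = unblocked₂ i₂ ¬trw

-- Descent on the value of `f`, with `m` bounding the steps left.
least : ∀ {X : Set} (f : X → ℕ) {P : X → Set} {x} → P x → ¬ ¬ (∃[ y ] (P y × (∀ z → P z → f y ≤ f z)))
least f {P} {x} = go (f x) ≤-refl
  where
  go : ∀ m {x} → f x ≤ m → P x → ¬ ¬ (∃[ y ] (P y × (∀ z → P z → f y ≤ f z)))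
  go m {x} x≤m px = do
    yes (y , py , y<x) ← em {P = ∃[ y ] (P y × f y < f x)}
      where no ¬y → return (x , px , λ y py → ≮⇒≥ (λ y<x → ¬y (y , py , y<x)))
    smaller m py (≤-trans y<x x≤m)
    where
    smaller : ∀ m {y} → P y → f y < m → ¬ ¬ (∃[ y ] (P y × (∀ z → P z → f y ≤ f z)))
    smaller (suc m) py (s≤s y≤m) = go m y≤m py

-- Existence of small sets of landmarks

module Construction {n} (G : Graph n) (d : Fin n → Fin n → ℕ)
                    (dist : ∀ {u v} → u ∈ vert G → v ∈ vert G → Dist G u v (d u v)) where

  open Metric G d dist
  open Landmarks G d dist
  open Good

  module _ (𝒪 : Objects) where
    open Objects 𝒪

    -- Unfolds to `IsDim` and `IsEdim` for the two kinds of objects.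
    IsMinimum : Graph n → ℕ → Set
    IsMinimum H k = (∃[ S ] (IsGenerator H S × countB S ≡ k)) × (∀ S → IsGenerator H S → k ≤ countB S)

    BlockBound : Set
    BlockBound = ∀ H → NontrivialBlock G H → ¬ IsCycle H → ∀ k → IsMinimum H k → k + 2 * ∣V∣ H ≤ 2 * ∣E∣ H + 1

    record Unrooted (A : Sub n) : Set where
      constructor unrooted
      field
        S        : Sub n
        S⊆A      : S ⊆ A
        size     : countB S + 2 * countB A ≤ 2 * ∣E∣ (G [ A ]) + 1
        resolves : Resolves (_∈ S) A

    -- One landmark fewer than in `Rooted`, in exchange for which blocked objects are allowed. The
    -- landmark `element` stands in for `w` when the rest of the graph looks into the leaf.
    record Leaf (A : Sub n) (w : Fin n) : Set where
      constructor leaf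
      field
        S        : Sub n
        S⊆A      : S ⊆ A
        size     : countB S + 2 * countB A ≤ 2 * ∣E∣ (G [ A ]) + 1
        resolves : Resolves (λ s → s ∈ S ⊎ s ≡ w) A
        {element} : Fin n
        nonempty : element ∈ S

    block-generator : BlockBound → ∀ {A} → Good A → TwoConnected (G [ A ]) → ¬ IsCycle (G [ A ]) → ¬ ¬ Unrooted A
    block-generator bound {A} g tc ¬cyc = do
      -- The full vertex set is a generator, so a smallest one exists and the bound on the block
      -- applies to it.
      S , gen , min ← least countB (full-generator g)
      let S⊆A , res = generator⇒resolves g gen
      return (unrooted S S⊆A (bound (G [ A ]) (block g tc) ¬cyc (countB S) ((S , gen , refl) , min)) res)

    module _ {A v S} (g : Good A) (vA : v ∈ A) (S⊆A : S ⊆ A) (res : Resolves (_∈ S) A) where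

      Blocked : Obj → Set
      Blocked o = In A o × ¬ Triv v o × (∀ {s} → s ∈ S → δ s o ≡ d s v + δ v o)

      farthest-blocked : ∀ {o} → Blocked o → ¬ ¬ (∃[ o* ] (Blocked o* × (∀ o′ → Blocked o′ → δ v o′ ≤ δ v o*)))
      farthest-blocked b = do
        let N , ≤N = δ-bounded v
        -- Distances from `v` are at most `N`, so minimising `N ∸ δ v o` finds the farthest object.
        o* , b* , min ← least (λ o → N ∸ δ v o) b
        return (o* , b* , λ o′ b′ → ≮⇒≥ (λ lt → ≤⇒≯ (min o′ b′) (∸-monoʳ-< lt (≤N o′))))

      blocked⊎witness : ∀ {o} → In A o → ¬ Triv v o → Blocked o ⊎ (∃[ s ] (s ∈ S × δ s o < d s v + δ v o))
      blocked⊎witness {o} i ¬tr with any? (λ s → s ∈? S ×-dec (δ s o ℕ.<? d s v + δ v o))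
      ... | yes w = inj₂ w
      ... | no ¬w = inj₁ (i , ¬tr , λ {s} s∈S →
        ≤-antisym (δ-triangle g (S⊆A s∈S) vA i) (≮⇒≥ (λ lt → ¬w (s , s∈S , lt))))

      -- S distinguishes blocked objects from each other, so there is one at each distance, and they lie on a
      -- geodesic from v to the farthest one: a single landmark at the end unblocks them all.
      record Unblocker : Set where
        constructor unblocker
        field
          t         : Fin n
          t∈A       : t ∈ A
          unblocked : Unblocked (_∈ (S ∪ ⁅ t ⁆)) v A

      unblock : ¬ ¬ Unblocker
      unblock = do
        yes (o , b) ← em {P = ∃[ o ] Blocked o}
          -- With nothing blocked, `v` is only a dummy value for the additional landmark.
          where no ¬b → return (unblocker v vA (λ i ¬tr →
                  [ (λ b → contradiction (_ , b) ¬b) , (λ (s , sS , lt) → s , ∪⁺ˡ sS , lt) ]′ (blocked⊎witness i ¬tr)))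
        o* , (i* , ¬tr* , b*) , max ← farthest-blocked b
        let t , tA , along = chain g vA i* ¬tr*
        return (unblocker t tA (λ i ¬tr →
          [ (λ b → t , ∪⁺ʳ (⁅⁆⁺ t) , end b b* (along i ¬tr (max _ b)))
          , (λ (s , sS , lt) → s , ∪⁺ˡ sS , lt) ]′ (blocked⊎witness i ¬tr)))
        where
        -- At equal distance from `v`, the blocked `o` and the object `o″` on the geodesic have
        -- equal distances from all of `S`. As `S` resolves, they are the same object, and `t`
        -- unblocks `o″`.
        end : ∀ {o o* t} → Blocked o → (∀ {s} → s ∈ S → δ s o* ≡ d s v + δ v o*) →
              ∃[ o″ ] (In A o″ × δ v o″ ≡ δ v o × (∀ {s} → s ∈ A → δ s o* ≡ d s v + δ v o* → δ s o″ ≡ d s v + δ v o″)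
                       × δ t o″ < d t v + δ v o″) →
              δ t o < d t v + δ v o
        end {o} {o*} {t} (i , ¬tr , b) b* (o″ , i″ , eq , geo , lt) with δ t o ℕ.<? d t v + δ v o
        ... | yes p = p
        ... | no ¬p = contradiction
          (λ o~o″ → ¬p (subst₂ (λ x y → x < d t v + y) (sym (δ-resp o~o″ t)) eq lt))
          (λ ¬o~o″ → let s , sS , ne = res i i″ ¬o~o″ in
            ne (trans (b sS) (trans (cong (d s v +_) (sym eq)) (sym (geo (S⊆A sS) (b* sS))))))

    rooted-block : ∀ {A v W} → Good A → v ∈ A → Unrooted A → ¬ ¬ Rooted 𝒪 A v W
    rooted-block {A} {v} {W} g vA (unrooted S S⊆A size res) = do
      unblocker t tA ub ← unblock g vA S⊆A res
      return (record
        { S = S ∪ ⁅ t ⁆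
        ; S⊆A = ∪-⊆ S⊆A (⁅⁆-⊆ tA)
        ; size = enlarge t size
        ; resolves = λ i i′ ne → let s , sS , h = res i i′ ne in s , inj₁ (inj₁ (∪⁺ˡ sS)) , h
        ; unblocked = λ i ¬tr → let s , sS , lt = ub i ¬tr in s , inj₁ sS , lt })
      where
      enlarge : ∀ {S a e} t → countB S + a ≤ e + 1 → countB (S ∪ ⁅ t ⁆) + a ≤ e + 2
      enlarge {S} {a} {e} t h = begin
        countB (S ∪ ⁅ t ⁆) + a  ≤⟨ +-monoˡ-≤ a (countB-∪ S ⁅ t ⁆) ⟩
        countB S + countB ⁅ t ⁆ + a ≡⟨ cong (λ k → countB S + k + a) (countB-⁅⁆ t) ⟩
        countB S + 1 + a        ≡⟨ cong (_+ a) (+-comm (countB S) 1) ⟩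
        suc (countB S + a)      ≤⟨ s≤s h ⟩
        suc (e + 1)             ≡⟨ sym (+-suc e 1) ⟩
        e + 2                   ∎
        where open ≤-Reasoning

    thin-resolves : ∀ {A v a} {P : Fin n → Set} → Good A → Thin G A → Edge G A v a → P a → P v → Resolves P A
    thin-resolves {v = v} {a} g th e Pa Pv {o} {o′} i i′ ne with δ v o ℕ.≟ δ v o′ | δ a o ℕ.≟ δ a o′
    ... | no h  | _     = v , Pv , h
    ... | yes _ | no h  = a , Pa , h
    ... | yes p | yes q = contradiction (thin g th e i i′ p q) ne

    -- Any one neighbour resolves together with the root, and all neighbours together unblock; those
    -- outside `S` must be marked.
    rooted-thin : ∀ {A v a S W} → Good A → Thin G A → Edge G A v a → S ⊆ A →
                  countB S + 2 * countB A ≤ 2 * ∣E∣ (G [ A ]) + 2 →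
                  (∀ {c} → Edge G A v c → Landmark 𝒪 A S W c) → Rooted 𝒪 A v W
    rooted-thin {S = S} g th e S⊆A size nbrs = record
      { S = S ; S⊆A = S⊆A ; size = size
      ; resolves = thin-resolves g th e (inj₁ (nbrs e)) (inj₂ refl)
      ; unblocked = λ i ¬tr → let s , f , lt = neighbour g (leftᵉ e) i ¬tr in s , nbrs f , lt }

    rooted-cycle : ∀ {A v W} → Good A → TwoConnected (G [ A ]) → IsCycle (G [ A ]) → v ∈ A → ¬ ¬ Rooted 𝒪 A v W
    rooted-cycle {A} {v} {W} g tc cyc vA = do
      a , b , ea , eb , ne ← TwoConnected⇒TwoNeighbours {G = G} tc vA
      E≥V ← TwoNeighbours⇒∣E∣ {G = G} {A} (TwoConnected⇒TwoNeighbours {G = G} tc)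
      return (rooted-thin {S = ⁅ a ⁆ ∪ ⁅ b ⁆} g th ea (∪-⊆ (⁅⁆-⊆ (rightᵉ ea)) (⁅⁆-⊆ (rightᵉ eb)))
        (size a b (∣E∣ (G [ A ])) E≥V) (λ e → inj₁ (among ea eb e ne)))
      where
      th : Thin G A
      th = IsCycle⇒Thin {G = G} {A} cyc
      size : ∀ a b {k} e → k ≤ e + e → countB (⁅ a ⁆ ∪ ⁅ b ⁆) + k ≤ 2 * e + 2
      size a b {k} e h = ≤-trans (+-mono-≤ (countB-pair-≤ a b) h)
        (≤-reflexive (trans (+-comm 2 (e + e)) (cong (λ x → e + x + 2) (sym (+-identityʳ e)))))
      among : ∀ {a b c} → Edge G A v a → Edge G A v b → Edge G A v c → a ≢ b → c ∈ (⁅ a ⁆ ∪ ⁅ b ⁆)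
      among {a} {b} ea eb ec ne with th ea eb ec
      ... | inj₁ p = contradiction p ne
      ... | inj₂ (inj₁ refl) = ∪⁺ˡ (⁅⁆⁺ a)
      ... | inj₂ (inj₂ refl) = ∪⁺ʳ (⁅⁆⁺ b)

    -- Here c = 0, so no landmark may be spent. The end `q` has only the neighbour `v` in `A`, so it
    -- must be marked, and what is attached there supplies the landmark.
    rooted-K₂ : ∀ {A v q W} → Good A → v ∈ A → q ∈ A → q ≢ v → (∀ {u} → u ∈ A → u ≡ v ⊎ u ≡ q) →
                TwoNeighbours G A q ⊎ q ∈ W → Rooted 𝒪 A v W
    rooted-K₂ {A} {v} {q} {W} g vA qA qv only deg-q = rooted-thin {S = ∅} g (⊆-pair⇒Thin only) v–q (λ { (mem ()) })
      size (λ e → inj₂ (rightᵉ e , subst (_∈ W) (sym (other e)) q∈W))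
      where
      other : ∀ {c} → Edge G A v c → c ≡ q
      other e = [ (λ c≡v → contradiction (sym c≡v) (adj⇒≢ {H = G} (adjᵉ e))) , (λ p → p) ]′ (only (rightᵉ e))
      back : ∀ {c} → Edge G A q c → c ≡ v
      back e = [ (λ p → p) , (λ c≡q → contradiction (sym c≡q) (adj⇒≢ {H = G} (adjᵉ e))) ]′ (only (rightᵉ e))
      v–q : Edge G A v q
      v–q = let a , e = first-edge {G = G} {A} (qv ∘ sym) (isometric g vA qA) in subst (Edge G A v) (other e) e
      q∈W : q ∈ W
      q∈W = [ (λ (a , b , ea , eb , ne) → contradiction (trans (back ea) (sym (back eb))) ne) , (λ p → p) ]′ deg-q
      degree≥1 : ∀ {u c} → Edge G A u c → 1 ≤ deg (G [ A ]) u
      degree≥1 {u} {c} e = subst (_≤ deg (G [ A ]) u) (countB-⁅⁆ c)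
        (countB-mono {A = ⁅ c ⁆} {adj (G [ A ]) u} (⁅⁆-⊆ (mem (edge⁺ e))))
      deg≥1 : ∀ {u} → u ∈ A → 1 ≤ deg (G [ A ]) u
      deg≥1 uA = [ (λ { refl → degree≥1 v–q }) , (λ { refl → degree≥1 (edge-sym v–q) }) ]′ (only uA)
      A≤2 : countB A ≤ 2
      A≤2 = ≤-trans (countB-mono λ p →
        [ (λ { refl → ∪⁺ˡ (⁅⁆⁺ _) }) , (λ { refl → ∪⁺ʳ (⁅⁆⁺ _) }) ]′ (only p)) (countB-pair-≤ v q)
      -- One copy of `a` is bounded by the degree sum, the other by 2.
      arith : ∀ {a e} → 1 * a ≤ e + e → a ≤ 2 → 2 * a ≤ 2 * e + 2
      arith {a} {e} h k = subst₂ _≤_ (cong (a +_) refl) (cong (λ x → e + x + 2) (sym (+-identityʳ e)))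
        (≤-trans (≤-reflexive (+-comm a (a + 0))) (+-mono-≤ h k))
      size : countB {n} ∅ + 2 * countB A ≤ 2 * ∣E∣ (G [ A ]) + 2
      size = subst (λ z → z + 2 * countB A ≤ 2 * ∣E∣ (G [ A ]) + 2) (sym (countB-∅ {n}))
        (arith {countB A} {∣E∣ (G [ A ])} (min-degree⇒∣E∣ (G [ A ]) 1 (λ p → deg≥1 (mem p))) A≤2)

    module _ (bound : BlockBound) where

      -- Induction on the number of vertices, bounded by `m`. A vertex other than the root may have
      -- lost neighbours only where another part was split off, and is then marked in `W`. The
      -- vertex `q` keeps `A` from being just the root.
      rooted : ∀ m {A v W q} → countB A < m → Good A → v ∈ A → q ∈ A → q ≢ v →
               (∀ {u} → u ∈ A → u ≢ v → TwoNeighbours G A u ⊎ u ∈ W) → ¬ ¬ Rooted 𝒪 A v W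
      rooted (suc m) {A} {v} {W} {q} (s≤s A≤m) g vA qA qv nbrs with 3 ℕ.≤? countB A
      ... | no small = return (rooted-K₂ g vA qA qv only (nbrs qA qv))
        where
        only : ∀ {u} → u ∈ A → u ≡ v ⊎ u ≡ q
        only {u} uA with u ≟ v | u ≟ q
        ... | yes p | _     = inj₁ p
        ... | no _  | yes p = inj₂ p
        ... | no uv | no uq = contradiction (triple-≤-countB uA vA qA uv uq (qv ∘ sym)) small
      ... | yes three = do
        inj₂ (w , A₁ , A₂ , s) ← TwoConnected⊎Split {G = G} {A} (connected g) three
          where inj₁ tc → em >>= λ { (yes cyc) → rooted-cycle g tc cyc vA
                                   ; (no ¬cyc) → block-generator bound g tc ¬cyc >>= rooted-block g vA }
        [ (λ v₁ → at-cut s v₁) , (λ v₂ → at-cut (split-sym s) v₂) ]′ (Split.cover s vA)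
        where
        at-cut : ∀ {A₁ A₂ w} → Split G A A₁ A₂ w → v ∈ A₁ → ¬ ¬ Rooted 𝒪 A v W
        at-cut {A₁} {A₂} {w} s v₁ = do
          let p , p₁ , pv = other-in-A₁
              z , z₂ , zw = far₂
          r₁ ← rooted m {W = W ∪ ⁅ w ⁆} (<-≤-trans (size₁ s) A≤m) (good₁ g s) v₁ p₁ pv nbrs₁
          r₂ ← rooted m {W = W} (<-≤-trans (size₁ (split-sym s)) A≤m) (good₁ g (split-sym s)) cut₂ z₂ zw nbrs₂
          return (rooted-glue 𝒪 g s v₁ r₁ r₂)
          where
          open Split s
          other-in-A₁ : ∃[ p ] (p ∈ A₁ × p ≢ v)
          other-in-A₁ with far₁
          ... | p , p₁ , pw with p ≟ v
          ...   | no pv    = p , p₁ , pv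
          -- If the vertex chosen away from the cut is the root, the cut vertex is the other one.
          ...   | yes refl = w , cut₁ , (pw ∘ sym)
          nbrs₁ : ∀ {u} → u ∈ A₁ → u ≢ v → TwoNeighbours G A₁ u ⊎ u ∈ (W ∪ ⁅ w ⁆)
          nbrs₁ {u} u₁ uv with u ≟ w
          ... | yes refl = inj₂ (∪⁺ʳ (⁅⁆⁺ u))
          ... | no uw = [ inj₁ ∘ two-neighbours₁ g s u₁ uw , inj₂ ∘ ∪⁺ˡ ]′ (nbrs (sub₁ u₁) uv)
          nbrs₂ : ∀ {u} → u ∈ A₂ → u ≢ w → TwoNeighbours G A₂ u ⊎ u ∈ W
          nbrs₂ u₂ uw = [ inj₁ ∘ two-neighbours₁ g (split-sym s) u₂ uw , inj₂ ]′
            (nbrs (sub₂ u₂) (λ { refl → uw (meet v₁ u₂) }))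

      leaf-block : ∀ {A w} → Good A → w ∈ A → TwoConnected (G [ A ]) → ¬ ¬ Leaf A w
      leaf-block {A} {w} g wA tc = do
        nbrs@(a , _ , e , _) ← TwoConnected⇒TwoNeighbours {G = G} tc wA
        no ¬cyc ← em {P = IsCycle (G [ A ])}
          where yes cyc → do
                  E≥V ← TwoNeighbours⇒∣E∣ {G = G} {A} (TwoConnected⇒TwoNeighbours {G = G} tc)
                  return (leaf ⁅ a ⁆ (⁅⁆-⊆ (rightᵉ e)) (size a (∣E∣ (G [ A ])) E≥V)
                    (thin-resolves g (IsCycle⇒Thin {G = G} {A} cyc) e (inj₁ (⁅⁆⁺ a)) (inj₂ refl)) (⁅⁆⁺ a))
        unrooted S S⊆A sz res ← block-generator bound g tc ¬cyc
        -- Two distinct objects have to be resolved, so `S` is not empty.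
        let o , o′ , i , i′ , ne = two-objects nbrs
            s , sS , _ = res i i′ ne
        return (leaf S S⊆A sz (λ i i′ ne → let s , sS , h = res i i′ ne in s , inj₁ sS , h) sS)
        where
        size : ∀ a {k} e → k ≤ e + e → countB ⁅ a ⁆ + k ≤ 2 * e + 1
        size a {k} e h rewrite countB-⁅⁆ a | +-identityʳ e | +-comm (e + e) 1 = s≤s h

      -- The sizes add up as (2c₁ - 1) + 2c₂ = 2c - 1. Both sides use `w` as a root, and each has a
      -- landmark replacing it for the other.
      unrooted-glue : ∀ {A A₁ A₂ w} → Good A → Split G A A₁ A₂ w →
        Leaf A₁ w → Rooted 𝒪 A₂ w ∅ → Unrooted A
      unrooted-glue {A} {A₁} {A₂} {w} g s (leaf S₁ S₁⊆ size res {t} t∈S₁) r₂ =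
        unrooted (S₁ ∪ R₂.S) (∪-⊆ (sub₁ ∘ S₁⊆) (sub₂ ∘ R₂.S⊆A)) (split-size s 1 S₁ R₂.S size R₂.size)
                 (resolves-glue 𝒪 g s both₁ both₂ (t , ∪⁺ˡ t∈S₁ , S₁⊆ t∈S₁) ub₂)
        where
        open Split s
        module R₂ = Rooted r₂
        from₂ : ∀ {x} → Landmark 𝒪 A₂ R₂.S ∅ x → x ∈ R₂.S
        from₂ (inj₁ p) = p
        ub₂ : Unblocked (λ x → x ∈ (S₁ ∪ R₂.S) × x ∈ A₂) w A₂
        ub₂ i ¬tr = let x , l , x< = R₂.unblocked i ¬tr in x , (∪⁺ʳ (from₂ l) , R₂.S⊆A (from₂ l)) , x<
        beyond : ∃[ b ] b ∈ R₂.S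
        beyond = let q , q₂ , qw = far₂
                     o , i , ¬tr = nontrivial (good₁ g (split-sym s)) cut₂ q₂ qw
                     b , l , _ = R₂.unblocked i ¬tr
                 in b , from₂ l
        both₁ : ∀ {o o′} → In A₁ o → In A₁ o′ → ¬ o ~ o′ → ∃[ t ] (t ∈ (S₁ ∪ R₂.S) × δ t o ≢ δ t o′)
        both₁ i i′ ne with res i i′ ne
        ... | x , inj₁ p , h    = x , ∪⁺ˡ p , h
        ... | x , inj₂ refl , h = let b , b∈ = beyond in
          b , ∪⁺ʳ b∈ , transfer₁ 𝒪 g (split-sym s) (R₂.S⊆A b∈) i i′ h
        both₂ : ∀ {o o′} → In A₂ o → In A₂ o′ → ¬ o ~ o′ → ∃[ t ] (t ∈ (S₁ ∪ R₂.S) × δ t o ≢ δ t o′)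
        both₂ i i′ ne with R₂.resolves i i′ ne
        ... | x , inj₁ l , h    = x , ∪⁺ʳ (from₂ l) , h
        ... | x , inj₂ refl , h = t , ∪⁺ˡ t∈S₁ , transfer₁ 𝒪 g s (S₁⊆ t∈S₁) i i′ h

      module _ (g : Good V) (nbrs : ∀ {u} → u ∈ V → TwoNeighbours G V u) where

        -- A₁ is split further until it is 2-connected, hence a leaf block of G.
        unrooted-split : ∀ m {A₁ A₂ w} → countB A₁ < m → Split G V A₁ A₂ w → ¬ ¬ Unrooted V
        unrooted-split (suc m) {A₁} {A₂} {w} (s≤s A₁≤m) s = do
          let p , p₁ , pw = far₁
              a , b , ea , eb , ne = two-neighbours₁ g s p₁ pw (nbrs (sub₁ p₁))
              three = triple-≤-countB p₁ (rightᵉ ea) (rightᵉ eb)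
                        (adj⇒≢ {H = G} (adjᵉ ea)) (adj⇒≢ {H = G} (adjᵉ eb)) ne
              q , q₂ , qw = far₂
          inj₂ (u , P , Q , t) ← TwoConnected⊎Split {G = G} {A₁} (connected (good₁ g s)) three
            where inj₁ tc → do
                    ℓ ← leaf-block (good₁ g s) cut₁ tc
                    r₂ ← rooted (suc (countB A₂)) ≤-refl (good₁ g (split-sym s)) cut₂ q₂ qw
                           (λ u₂ uw → inj₁ (two-neighbours₁ g (split-sym s) u₂ uw (nbrs (sub₂ u₂))))
                    return (unrooted-glue g s ℓ r₂)
          -- A part containing `w` is merged into `A₂`; the other, strictly smaller than `A₁`, is
          -- the next candidate for a leaf.
          [ (λ w∈P → unrooted-split m (<-≤-trans (size₁ (split-sym t)) A₁≤m) (split-refine s t w∈P))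
            , (λ w∈Q → unrooted-split m (<-≤-trans (size₁ t) A₁≤m) (split-refine s (split-sym t) w∈Q)) ]′
            (Split.cover t cut₁)
          where open Split s

        unrooted-V : ∀ {u} → u ∈ V → ¬ IsCycle (G [ V ]) → ¬ ¬ Unrooted V
        unrooted-V uV ¬cyc = do
          let a , b , ea , eb , ne = nbrs uV
              three = triple-≤-countB uV (rightᵉ ea) (rightᵉ eb)
                        (adj⇒≢ {H = G} (adjᵉ ea)) (adj⇒≢ {H = G} (adjᵉ eb)) ne
          inj₂ (w , A₁ , A₂ , s) ← TwoConnected⊎Split {G = G} {V} (connected g) three
            where inj₁ tc → block-generator bound g tc ¬cyc
          unrooted-split (suc (countB A₁)) ≤-refl s

-- Vertices and edges as objects

module Instances {n} (G : Graph n) (d : Fin n → Fin n → ℕ)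
                 (dist : ∀ {u v} → u ∈ vert G → v ∈ vert G → Dist G u v (d u v)) where

  open Metric G d dist
  open Landmarks G d dist
  open Good

  -- In a graph of maximum degree 2 a non-backtracking walk is determined by its first edge and its length.
  data Trail (A : Sub n) (v c : Fin n) : ℕ → Fin n → Fin n → Set where
    start  : Edge G A v c → Trail A v c 0 v c
    extend : ∀ {k x y z} → Trail A v c k x y → Edge G A y z → z ≢ x → Trail A v c (suc k) y z

  trail-edge : ∀ {A v c k x y} → Trail A v c k x y → Edge G A x y
  trail-edge (start e)      = e
  trail-edge (extend _ e _) = e

  trail-unique : ∀ {A v c k x y x′ y′} → Thin G A → Trail A v c k x y → Trail A v c k x′ y′ → x ≡ x′ × y ≡ y′
  trail-unique th (start _) (start _) = refl , refl
  trail-unique th (extend t e ne) (extend t′ e′ ne′) with trail-unique th t t′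
  ... | refl , refl with th (edge-sym (trail-edge t)) e e′
  ...   | inj₁ x≡z         = contradiction (sym x≡z) ne
  ...   | inj₂ (inj₁ x≡z′) = contradiction (sym x≡z′) ne′
  ...   | inj₂ (inj₂ z≡z′) = refl , z≡z′

  module _ {A} (g : Good A) where

    d-stepˡ : ∀ {v c y} → Edge G A v c → y ∈ A → d v y ≤ suc (d c y)
    d-stepˡ {c = c} {y} e yA = ≤-trans (d-triangle (inV g (leftᵉ e)) (inV g (rightᵉ e)) (inV g yA))
      (+-monoˡ-≤ (d c y) (d-adj (adjᵉ e)))

    d-symᴬ : ∀ {x y} → x ∈ A → y ∈ A → d x y ≡ d y x
    d-symᴬ p q = d-sym (inV g p) (inV g q)

    d-stepʳ : ∀ {v x y} → v ∈ A → Edge G A x y → d v y ≤ suc (d v x)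
    d-stepʳ {v} {x} {y} vA e = subst₂ (λ a b → a ≤ suc b) (d-symᴬ (rightᵉ e) vA) (d-symᴬ (leftᵉ e) vA)
      (d-stepˡ (edge-sym e) vA)

    -- Built back from `y`: its neighbour one step nearer to `c` is also one step nearer to `v`.
    -- Distances from `v` grow along the trail, so it never turns back.
    geodesic-trail : ∀ {v c y} k → Edge G A v c → y ∈ A → d v y ≡ suc k → d c y ≡ k →
                     ∃[ x ] (Trail A v c k x y × d v x ≡ k)
    geodesic-trail {v} {c} {y} zero e yA vy cy with d≡0⇒≡ (inV g (rightᵉ e)) (inV g yA) cy
    ... | refl = v , start e , d-refl (inV g (leftᵉ e))
    geodesic-trail {v} {c} {y} (suc k) e yA vy cy =
      let p , f , pc = step-towards g yA (rightᵉ e) (trans (d-symᴬ yA (rightᵉ e)) cy)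
          cp = trans (d-symᴬ (rightᵉ e) (rightᵉ f)) pc
          vp = ≤-antisym (subst (λ m → d v p ≤ suc m) cp (d-stepˡ e (rightᵉ f)))
                         (ℕ.s≤s⁻¹ (subst (_≤ suc (d v p)) vy (d-stepʳ (leftᵉ e) (edge-sym f))))
          x , t , vx = geodesic-trail k e (rightᵉ f) vp cp
      in p , extend t (edge-sym f) (λ y≡x → m≢1+n+m k (trans (sym vx) (trans (cong (d v) (sym y≡x)) vy))) , vp

    -- Two of the three neighbours `a`, `c`, `c′` coincide. Either the first steps are equal, or one
    -- of them is `a`, where `δ` and `δ′` agree.
    first-steps-agree : ∀ {v a k} {δ δ′ : Fin n → ℕ} → Thin G A → Edge G A v a → δ a ≡ δ′ a →
      (∃[ c ] (Edge G A v c × δ c ≡ k)) → (∃[ c ] (Edge G A v c × δ′ c ≡ k)) →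
      ∃[ c ] (Edge G A v c × δ c ≡ k × δ′ c ≡ k)
    first-steps-agree th ea eq (c , e , p) (c′ , e′ , p′) with th ea e e′
    ... | inj₁ refl        = c , e , p , trans (sym eq) p
    ... | inj₂ (inj₁ refl) = c′ , e′ , trans eq p′ , p′
    ... | inj₂ (inj₂ refl) = c , e , p , p′

    advance : ∀ {v y p i} → v ∈ A → y ∈ A → p ∈ A → d v p ≡ i → i + d p y ≡ d v y → i < d v y →
              ∃[ c ] (Edge G A p c × d v c ≡ suc i × suc i + d c y ≡ d v y)
    advance {v} {y} {p} {i} vA yA pA vp eq lt with d p y in py
    ... | zero  = contradiction lt (<-irrefl (trans (sym (+-identityʳ i)) eq))
    ... | suc m =
      let c , e , cy = step-towards g pA yA py
          total = trans (cong (suc i +_) cy) (trans (sym (+-suc i m)) eq)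
      in c , e , ≤-antisym (subst (λ j → d v c ≤ suc j) vp (d-stepʳ vA e))
                   (+-cancelʳ-≤ (d c y) _ _ (subst (_≤ d v c + d c y) (sym total)
                     (d-triangle (inV g vA) (inV g (rightᵉ e)) (inV g yA)))) , total

    between : ∀ {v y} i → v ∈ A → y ∈ A → i ≤ d v y → ∃[ p ] (p ∈ A × d v p ≡ i × i + d p y ≡ d v y)
    between {v} zero vA yA _ = v , vA , d-refl (inV g vA) , refl
    between (suc i) vA yA lt =
      let p , pA , vp , eq = between i vA yA (<⇒≤ lt)
          c , e , vc , eq′ = advance vA yA pA vp eq lt
      in c , rightᵉ e , vc , eq′

  vertices : Objects
  vertices = record
    { Obj = Fin n
    ; _~_ = _≡_
    ; In = λ A o → o ∈ A
    ; δ = d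
    ; Triv = λ v o → o ≡ v
    ; triv? = λ v o → o ≟ v
    ; δ-resp = λ { refl s → refl }
    ; δ-triangle = λ g s t o → d-triangle (inV g s) (inV g t) (inV g o)
    ; δ-bounded = λ v → sumF (d v) , ≤-sumF (d v)
    ; In-mono = λ h i → h i
    ; In-split = λ s i → Split.cover s i
    ; Triv-in = λ { w refl → w }
    ; δ-gate = λ g sp sA oA → gate g sp sA oA
    ; inhabited = λ {A} {o} i → o , i
    ; nontrivial = λ {A} {w} {q} g wA qA ne → q , qA , ne
    ; two-objects = λ (a , b , ea , eb , ne) → a , b , rightᵉ ea , rightᵉ eb , ne
    ; neighbour = neighbour
    ; thin = thin
    ; chain = chain
    ; IsGenerator = VertexMetricGenerator
    ; generator⇒resolves = λ g (sub , sep) → (λ (mem p) → mem (sub _ p)) , λ (mem i) (mem i′) ne →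
        let s , sS , a , b , da , db , a≢b = sep _ _ i i′ ne
        in s , mem sS , λ eq → a≢b (trans (dist-unique g da) (trans eq (sym (dist-unique g db))))
    ; full-generator = λ g → (λ s p → p) , λ x x′ p p′ ne →
        x , p , d x x , d x x′ , dist-induced g (mem p) (mem p) , dist-induced g (mem p) (mem p′) ,
        λ eq → ne (d≡0⇒≡ (inV g (mem p)) (inV g (mem p′)) (trans (sym eq) (d-refl (inV g (mem p)))))
    ; resolves⇒generator = λ g S⊆V res → (λ s p → true∈ (S⊆V (mem p))) , λ x x′ p p′ ne →
        let s , sS , h = res (mem p) (mem p′) ne
        in s , true∈ sS , d s x , d s x′ , dist (S⊆V sS) (mem p) , dist (S⊆V sS) (mem p′) , h
    }
    where
    first-step : ∀ {A v o k} → Good A → v ∈ A → o ∈ A → d v o ≡ suc k → ∃[ c ] (Edge G A v c × d c o ≡ k)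
    first-step g vA oA eq = step-towards g vA oA eq

    neighbour : ∀ {A v o} → Good A → v ∈ A → o ∈ A → o ≢ v → ∃[ s ] (Edge G A v s × d s o < d s v + d v o)
    neighbour {v = v} {o} g vA oA ne with d v o in eq
    ... | zero  = contradiction (sym (d≡0⇒≡ (inV g vA) (inV g oA) eq)) ne
    ... | suc k = let c , e , co = first-step g vA oA eq
                  in c , e , subst (_< d c v + suc k) (sym co) (m≤n+m (suc k) (d c v))

    -- Both vertices end trails with the same first edge and the same length.
    thin : ∀ {A v a o o′} → Good A → Thin G A → Edge G A v a → o ∈ A → o′ ∈ A →
           d v o ≡ d v o′ → d a o ≡ d a o′ → o ≡ o′
    thin {v = v} {a} {o} {o′} g th ea oA oA′ p q with d v o in eq
    ... | zero  = trans (sym (d≡0⇒≡ (inV g (leftᵉ ea)) (inV g oA) eq)) (d≡0⇒≡ (inV g (leftᵉ ea)) (inV g oA′) (sym p))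
    ... | suc k =
      let c , e , co , co′ = first-steps-agree g {δ = λ s → d s o} {λ s → d s o′} th ea q
                               (first-step g (leftᵉ ea) oA eq) (first-step g (leftᵉ ea) oA′ (sym p))
          x , t , _ = geodesic-trail g k e oA eq co
          x′ , t′ , _ = geodesic-trail g k e oA′ (sym p) co′
      in proj₂ (trail-unique th t t′)

    -- The end `t` is `o` itself. If the geodesic from `s` to `o` may run through `v`, so may the
    -- one from `s` to any vertex `p` between `v` and `o`.
    chain : ∀ {A v o} → Good A → v ∈ A → o ∈ A → o ≢ v →
            ∃[ t ] (t ∈ A × (∀ {o′} → o′ ∈ A → o′ ≢ v → d v o′ ≤ d v o →
              ∃[ p ] (p ∈ A × d v p ≡ d v o′ × (∀ {s} → s ∈ A → d s o ≡ d s v + d v o → d s p ≡ d s v + d v p)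
                       × d t p < d t v + d v p)))
    chain {A} {v} {o} g vA oA o≢v = o , oA , λ {o′} oA′ ne le →
      let p , pA , vp , eq = between g (d v o′) vA oA le
      in p , pA , vp , (λ sA h → along sA pA (trans (cong (_+ d p o) vp) eq) h) ,
         before pA (trans (cong (_+ d p o) vp) eq) (subst (0 <_) (sym vp) (d-pos (inV g vA) (inV g oA′) (ne ∘ sym)))
      where
      open ≤-Reasoning
      along : ∀ {s p} → s ∈ A → p ∈ A → d v p + d p o ≡ d v o → d s o ≡ d s v + d v o → d s p ≡ d s v + d v p
      along {s} {p} sA pA eq h = ≤-antisym (d-triangle (inV g sA) (inV g vA) (inV g pA))
        (+-cancelʳ-≤ (d p o) _ _ (begin
          d s v + d v p + d p o    ≡⟨ +-assoc (d s v) _ _ ⟩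
          d s v + (d v p + d p o)  ≡⟨ cong (d s v +_) eq ⟩
          d s v + d v o            ≡⟨ sym h ⟩
          d s o                    ≤⟨ d-triangle (inV g sA) (inV g pA) (inV g oA) ⟩
          d s p + d p o            ∎))
      before : ∀ {p} → p ∈ A → d v p + d p o ≡ d v o → 0 < d v p → d o p < d o v + d v p
      before {p} pA eq pos = begin-strict
        d o p           ≡⟨ d-symᴬ g oA pA ⟩
        d p o           <⟨ m<n+m (d p o) pos ⟩
        d v p + d p o   ≡⟨ eq ⟩
        d v o           ≡⟨ d-symᴬ g vA oA ⟩
        d o v           ≤⟨ m≤m+n _ _ ⟩
        d o v + d v p   ∎

  -- Distances from vertices to edges

  private
    infix 4 _≈_
    _≈_ : Fin n × Fin n → Fin n × Fin n → Set
    (v , w) ≈ (v′ , w′) = (v ≡ v′ × w ≡ w′) ⊎ (v ≡ w′ × w ≡ v′)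

    InE : Sub n → Fin n × Fin n → Set
    InE A (v , w) = Edge G A v w

    dᵉ : Fin n → Fin n × Fin n → ℕ
    dᵉ s (v , w) = d s v ⊓ d s w

    ≈-trans-sym : ∀ {o o₁ o′} → o ≈ o₁ → o′ ≈ o₁ → o ≈ o′
    ≈-trans-sym (inj₁ (refl , refl)) (inj₁ (refl , refl)) = inj₁ (refl , refl)
    ≈-trans-sym (inj₁ (refl , refl)) (inj₂ (refl , refl)) = inj₂ (refl , refl)
    ≈-trans-sym (inj₂ (refl , refl)) (inj₁ (refl , refl)) = inj₂ (refl , refl)
    ≈-trans-sym (inj₂ (refl , refl)) (inj₂ (refl , refl)) = inj₁ (refl , refl)

    dᵉ-resp : ∀ {o o′} → o ≈ o′ → ∀ s → dᵉ s o ≡ dᵉ s o′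
    dᵉ-resp (inj₁ (refl , refl)) s = refl
    dᵉ-resp {v , w} (inj₂ (refl , refl)) s = ⊓-comm (d s v) (d s w)

    dᵉ-self : ∀ {A x y} → Good A → Edge G A x y → dᵉ x (x , y) ≡ 0
    dᵉ-self {x = x} {y} g e = cong (_⊓ d x y) (d-refl (inV g (leftᵉ e)))

    dᵉ-triangle : ∀ {A s t o} → Good A → s ∈ A → t ∈ A → InE A o → dᵉ s o ≤ d s t + dᵉ t o
    dᵉ-triangle {s = s} {t} {x , y} g sA tA e = ≤-trans
      (⊓-mono-≤ (d-triangle (inV g sA) (inV g tA) (inV g (leftᵉ e))) (d-triangle (inV g sA) (inV g tA) (inV g (rightᵉ e))))
      (≤-reflexive (sym (+-distribˡ-⊓ (d s t) (d t x) (d t y))))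

    record Oriented (A : Sub n) (v : Fin n) (o : Fin n × Fin n) : Set where
      constructor oriented
      field
        {near far} : Fin n
        e     : Edge G A near far
        same  : o ≈ (near , far)
        δ≡    : dᵉ v o ≡ d v near

    orient : ∀ {A} v o → InE A o → Oriented A v o
    orient v (x , y) e with ≤-total (d v x) (d v y)
    ... | inj₁ le = oriented e (inj₁ (refl , refl)) (m≤n⇒m⊓n≡m le)
    ... | inj₂ ge = oriented (edge-sym e) (inj₂ (refl , refl)) (m≥n⇒m⊓n≡n ge)

    first-stepᵉ : ∀ {A v o k} → Good A → v ∈ A → InE A o → dᵉ v o ≡ suc k → ∃[ c ] (Edge G A v c × dᵉ c o ≡ k)
    first-stepᵉ {v = v} {o} {k} g vA i eq =
      let oriented {x} {y} e same δ≡ = orient v o i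
          c , f , cx = step-towards g vA (leftᵉ e) (trans (sym δ≡) eq)
      in c , f , ≤-antisym
        (≤-trans (≤-reflexive (dᵉ-resp same c)) (≤-trans (m⊓n≤m (d c x) (d c y)) (≤-reflexive cx)))
        (+-cancelˡ-≤ 1 k _ (subst (_≤ 1 + dᵉ c o) eq
          (≤-trans (dᵉ-triangle g vA (rightᵉ f) i) (+-monoˡ-≤ (dᵉ c o) (d-adj (adjᵉ f))))))

    edge-trail : ∀ {A v c o k} → Good A → Edge G A v c → InE A o → dᵉ v o ≡ suc k → dᵉ c o ≡ k →
                 ∃[ x ] ∃[ y ] (o ≈ (x , y) × Trail A v c (suc k) x y)
    edge-trail {A} {v} {c} {o} {k} g f i eq eq′ = go (orient c o i)
      where
      go : Oriented A c o → ∃[ x ] ∃[ y ] (o ≈ (x , y) × Trail A v c (suc k) x y)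
      go (oriented {x} {y} e same δ≡) =
        let cx = trans (sym δ≡) eq′
            dv = trans (sym (dᵉ-resp same v)) eq
            vx = ≤-antisym (subst (λ m → d v x ≤ suc m) cx (d-stepˡ g f (leftᵉ e)))
                           (subst (_≤ d v x) dv (m⊓n≤m (d v x) (d v y)))
            p , t , vp = geodesic-trail g k f (leftᵉ e) vx cx
            k<vy = subst (_≤ d v y) dv (m⊓n≤n (d v x) (d v y))
        -- The far end `y` is farther from `v` than `p`, so the edge does not run back along the
        -- trail.
        in x , y , same , extend t e (λ y≡p → <-irrefl (sym (trans (cong (d v) y≡p) vp)) k<vy)

    thinᵉ : ∀ {A v a o o′} → Good A → Thin G A → Edge G A v a → InE A o → InE A o′ →
            dᵉ v o ≡ dᵉ v o′ → dᵉ a o ≡ dᵉ a o′ → o ≈ o′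
    thinᵉ {A} {v} {a} {o} {o′} g th ea i i′ p q with dᵉ v o in eq
    ... | suc k =
      let c , f , co , co′ = first-steps-agree g {δ = λ s → dᵉ s o} {λ s → dᵉ s o′} th ea q
                               (first-stepᵉ g (leftᵉ ea) i eq) (first-stepᵉ g (leftᵉ ea) i′ (sym p))
          x , y , same , t = edge-trail g f i eq co
          x′ , y′ , same′ , t′ = edge-trail g f i′ (sym p) co′
          xx′ , yy′ = trail-unique th t t′
      in ≈-trans-sym same (subst₂ (λ x y → o′ ≈ (x , y)) (sym xx′) (sym yy′) same′)
    -- Both edges contain `v`, which has at most one neighbour besides `a`; distance 0 from `a`
    -- singles out the edge to `a`.
    ... | zero = at-v (orient v o i) (orient v o′ i′)
      where
      vA = leftᵉ ea
      hits : ∀ {y} → Edge G A v y → dᵉ a (v , y) ≡ 0 → a ≡ y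
      hits {y} e h with ⊓-sel (d a v) (d a y)
      ... | inj₁ h₁ = contradiction (sym (d≡0⇒≡ (inV g (rightᵉ ea)) (inV g vA) (trans (sym h₁) h))) (adj⇒≢ {H = G} (adjᵉ ea))
      ... | inj₂ h₂ = d≡0⇒≡ (inV g (rightᵉ ea)) (inV g (rightᵉ e)) (trans (sym h₂) h)
      same-end : ∀ {y y′} → Edge G A v y → Edge G A v y′ → dᵉ a (v , y) ≡ dᵉ a (v , y′) → y ≡ y′
      same-end e e′ h with th ea e e′
      ... | inj₁ refl        = hits e′ (trans (sym h) (trans (⊓-comm _ (d a a)) (dᵉ-self g (edge-sym ea))))
      ... | inj₂ (inj₁ refl) = sym (hits e (trans h (trans (⊓-comm _ (d a a)) (dᵉ-self g (edge-sym ea)))))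
      ... | inj₂ (inj₂ yy′)  = yy′
      at-v : Oriented A v o → Oriented A v o′ → o ≈ o′
      at-v (oriented e same δ≡) (oriented e′ same′ δ≡′)
        with d≡0⇒≡ (inV g vA) (inV g (leftᵉ e)) (trans (sym δ≡) eq)
           | d≡0⇒≡ (inV g vA) (inV g (leftᵉ e′)) (trans (sym δ≡′) (sym p))
      ... | refl | refl with same-end e e′ (trans (sym (dᵉ-resp same a)) (trans q (dᵉ-resp same′ a)))
      ...   | refl = ≈-trans-sym same same′

    neighbourᵉ : ∀ {A v o} → Good A → v ∈ A → InE A o → ∃[ s ] (Edge G A v s × dᵉ s o < d s v + dᵉ v o)
    neighbourᵉ {A} {v} {o} g vA i with dᵉ v o in eq
    ... | suc k = let c , f , co = first-stepᵉ g vA i eq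
                  in c , f , subst (_< d c v + suc k) (sym co) (m≤n+m (suc k) (d c v))
    -- An edge at `v` is unblocked by its other end, at distance 0 from it.
    ... | zero = at-v (orient v o i)
      where
      at-v : Oriented A v o → ∃[ s ] (Edge G A v s × dᵉ s o < d s v + 0)
      at-v (oriented {far = y} e same δ≡) with d≡0⇒≡ (inV g vA) (inV g (leftᵉ e)) (trans (sym δ≡) eq)
      ... | refl = y , e , subst₂ _<_
        (sym (trans (dᵉ-resp same y) (trans (⊓-comm (d y v) (d y y)) (dᵉ-self g (edge-sym e)))))
        (sym (+-identityʳ _))
        (d-pos (inV g (rightᵉ e)) (inV g vA) (adj⇒≢ {H = G} (adjᵉ e) ∘ sym))

    -- If `o` contains `v`, the only distance to serve is 0 and the other end of `o` will do.
    -- Otherwise `t` is the end `x` of `o` nearer to `v`, and the `o″` are `o` and the edges of a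
    -- geodesic from `v` to `x`.
    chainᵉ : ∀ {A v o} → Good A → v ∈ A → InE A o →
             ∃[ t ] (t ∈ A × (∀ {o′} → InE A o′ → ¬ ⊥ → dᵉ v o′ ≤ dᵉ v o →
               ∃[ o″ ] (InE A o″ × dᵉ v o″ ≡ dᵉ v o′
                        × (∀ {s} → s ∈ A → dᵉ s o ≡ d s v + dᵉ v o → dᵉ s o″ ≡ d s v + dᵉ v o″)
                        × dᵉ t o″ < d t v + dᵉ v o″)))
    chainᵉ {A} {v} {o} g vA i with dᵉ v o in eq
    ... | zero = let s , f , lt = neighbourᵉ g vA i in
      s , rightᵉ f , λ _ _ le → o , i , trans eq (sym (n≤0⇒n≡0 le)) ,
      (λ _ h → trans h (cong (_ +_) (sym eq))) , lt
    ... | suc r = towards (orient v o i)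
      where
      open ≤-Reasoning
      towards : Oriented A v o → _
      towards (oriented {x} {y} e same δ≡) = x , leftᵉ e , λ {o′} _ _ le → pick (dᵉ v o′) (m≤n⇒m<n∨m≡n le)
        where
        vx : d v x ≡ suc r
        vx = trans (sym δ≡) eq
        pick : ∀ j → j < suc r ⊎ j ≡ suc r →
               ∃[ o″ ] (InE A o″ × dᵉ v o″ ≡ j
                        × (∀ {s} → s ∈ A → dᵉ s o ≡ d s v + suc r → dᵉ s o″ ≡ d s v + dᵉ v o″)
                        × dᵉ x o″ < d x v + dᵉ v o″)
        pick j (inj₂ refl) = o , i , eq , (λ _ h → trans h (cong (_ +_) (sym eq))) , (begin-strict
          dᵉ x o          ≡⟨ trans (dᵉ-resp same x) (dᵉ-self g e) ⟩
          0               <⟨ s≤s z≤n ⟩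
          suc r           ≡⟨ sym eq ⟩
          dᵉ v o          ≤⟨ m≤n+m _ _ ⟩
          d x v + dᵉ v o  ∎)
        pick j (inj₁ lt) with between g j vA (leftᵉ e) (subst (j ≤_) (sym vx) (<⇒≤ lt))
        ... | p , pA , vp , jp with advance g vA (leftᵉ e) pA vp jp (subst (j <_) (sym vx) lt)
        ...   | c , f , vc , jc = (p , c) , f , vpc , geo , (begin-strict
          d x p ⊓ d x c   ≤⟨ m⊓n≤n (d x p) (d x c) ⟩
          d x c           ≡⟨ d-symᴬ g (leftᵉ e) (rightᵉ f) ⟩
          d c x           <⟨ m<n+m (d c x) (s≤s z≤n) ⟩
          suc j + d c x   ≡⟨ jc ⟩
          d v x           ≡⟨ d-symᴬ g vA (leftᵉ e) ⟩
          d x v           ≤⟨ m≤m+n _ _ ⟩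
          d x v + dᵉ v (p , c) ∎)
          where
          vpc : dᵉ v (p , c) ≡ j
          vpc = trans (cong₂ _⊓_ vp vc) (m≤n⇒m⊓n≡m (n≤1+n j))
          geo : ∀ {s} → s ∈ A → dᵉ s o ≡ d s v + suc r → dᵉ s (p , c) ≡ d s v + dᵉ v (p , c)
          geo {s} sA h = ≤-antisym (dᵉ-triangle g sA vA f)
            (subst (λ m → d s v + m ≤ dᵉ s (p , c)) (sym vpc)
              (⊓-glb (far-from pA jp) (≤-trans (+-monoʳ-≤ (d s v) (n≤1+n j)) (far-from (rightᵉ f) jc))))
            where
            far-from : ∀ {q l} → q ∈ A → l + d q x ≡ d v x → d s v + l ≤ d s q
            far-from {q} {l} qA eq′ = +-cancelʳ-≤ (d q x) _ _ (begin
              d s v + l + d q x    ≡⟨ +-assoc (d s v) l _ ⟩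
              d s v + (l + d q x)  ≡⟨ cong (d s v +_) (trans eq′ vx) ⟩
              d s v + suc r        ≡⟨ sym h ⟩
              dᵉ s o               ≡⟨ dᵉ-resp same s ⟩
              d s x ⊓ d s y        ≤⟨ m⊓n≤m (d s x) (d s y) ⟩
              d s x                ≤⟨ d-triangle (inV g sA) (inV g qA) (inV g (leftᵉ e)) ⟩
              d s q + d q x        ∎)

    distE-unique : ∀ {A s v w k} → Good A → DistE (G [ A ]) s v w k → k ≡ dᵉ s (v , w)
    distE-unique g (a , b , da , db , eq) = trans eq (cong₂ _⊓_ (dist-unique g da) (dist-unique g db))

    distE-induced : ∀ {A s v w} → Good A → s ∈ A → Edge G A v w → DistE (G [ A ]) s v w (dᵉ s (v , w))
    distE-induced g sA e = _ , _ , dist-induced g sA (leftᵉ e) , dist-induced g sA (rightᵉ e) , refl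

    -- An edge at distance 0 from both ends of another edge is that edge.
    full-generatorᵉ : ∀ {A} → Good A → EdgeMetricGenerator (G [ A ]) A
    full-generatorᵉ {A} g = (λ s p → p) , λ v w v′ w′ p p′ ne → separate (edge⁻ {G = G} {A} p) (edge⁻ {G = G} {A} p′) ne
      where
      endpoint : ∀ {s v w} → s ∈ A → Edge G A v w → dᵉ s (v , w) ≡ 0 → s ≡ v ⊎ s ≡ w
      endpoint {s} {v} {w} sA e h with ⊓-sel (d s v) (d s w)
      ... | inj₁ q = inj₁ (d≡0⇒≡ (inV g sA) (inV g (leftᵉ e)) (trans (sym q) h))
      ... | inj₂ q = inj₂ (d≡0⇒≡ (inV g sA) (inV g (rightᵉ e)) (trans (sym q) h))
      by : ∀ {s v w v′ w′} → s ∈ A → Edge G A v w → Edge G A v′ w′ → dᵉ s (v , w) ≢ dᵉ s (v′ , w′) →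
           ∃[ s ] (A s ≡ true × ∃[ a ] ∃[ b ] (DistE (G [ A ]) s v w a × DistE (G [ A ]) s v′ w′ b × a ≢ b))
      by {s} sA e e′ h = s , true∈ sA , _ , _ , distE-induced g sA e , distE-induced g sA e′ , h
      separate : ∀ {v w v′ w′} → Edge G A v w → Edge G A v′ w′ → ¬ (v , w) ≈ (v′ , w′) →
        ∃[ s ] (A s ≡ true × ∃[ a ] ∃[ b ] (DistE (G [ A ]) s v w a × DistE (G [ A ]) s v′ w′ b × a ≢ b))
      separate {v} {w} {v′} {w′} e e′ ne
        with dᵉ v (v , w) ℕ.≟ dᵉ v (v′ , w′) | dᵉ w (v , w) ℕ.≟ dᵉ w (v′ , w′)
      ... | no h  | _     = by (leftᵉ e) e e′ h
      ... | yes _ | no h  = by (rightᵉ e) e e′ h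
      ... | yes p | yes q = contradiction (match
          (endpoint (leftᵉ e) e′ (trans (sym p) (dᵉ-self g e)))
          (endpoint (rightᵉ e) e′ (trans (sym q) (trans (⊓-comm (d w v) (d w w)) (dᵉ-self g (edge-sym e)))))) ne
        where
        match : v ≡ v′ ⊎ v ≡ w′ → w ≡ v′ ⊎ w ≡ w′ → (v , w) ≈ (v′ , w′)
        match (inj₁ a) (inj₂ b) = inj₁ (a , b)
        match (inj₂ a) (inj₁ b) = inj₂ (a , b)
        match (inj₁ a) (inj₁ b) = contradiction (trans a (sym b)) (adj⇒≢ {H = G} (adjᵉ e))
        match (inj₂ a) (inj₂ b) = contradiction (trans a (sym b)) (adj⇒≢ {H = G} (adjᵉ e))

  edges : Objects
  edges = record
    { Obj = Fin n × Fin n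
    ; _~_ = _≈_
    ; In = InE
    ; δ = dᵉ
    ; Triv = λ _ _ → ⊥
    ; triv? = λ _ _ → no λ ()
    ; δ-resp = dᵉ-resp
    ; δ-triangle = dᵉ-triangle
    ; δ-bounded = λ v → sumF (d v) , λ (x , y) → ≤-trans (m⊓n≤m (d v x) (d v y)) (≤-sumF (d v) x)
    ; In-mono = λ h e → edge-mono h e
    ; In-split = λ s e → edge-split s e
    ; Triv-in = λ _ ()
    ; δ-gate = λ {A} {A₁} {A₂} {w} {s} {o} g sp sA e →
        trans (cong₂ _⊓_ (gate g sp sA (leftᵉ e)) (gate g sp sA (rightᵉ e)))
              (sym (+-distribˡ-⊓ (d s w) (d w (proj₁ o)) (d w (proj₂ o))))
    ; inhabited = λ {A} {o} e → proj₁ o , leftᵉ e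
    ; nontrivial = λ {A} {w} {q} g wA qA ne →
        let a , e = first-edge {G = G} {A} (ne ∘ sym) (isometric g wA qA) in (w , a) , e , λ ()
    ; two-objects = λ {A} {v} (a , b , ea , eb , ne) → (v , a) , (v , b) , ea , eb ,
        [ ne ∘ proj₂ , adj⇒≢ {H = G} (adjᵉ eb) ∘ proj₁ ]′
    ; neighbour = λ g vA i _ → neighbourᵉ g vA i
    ; thin = thinᵉ
    ; chain = λ g vA i _ → chainᵉ g vA i
    ; IsGenerator = EdgeMetricGenerator
    ; generator⇒resolves = λ g (sub , sep) → (λ (mem p) → mem (sub _ p)) , λ i i′ ne →
        let s , sS , a , b , da , db , a≢b = sep _ _ _ _ (edge⁺ {G = G} i) (edge⁺ {G = G} i′) ne
        in s , mem sS , λ eq → a≢b (trans (distE-unique g da) (trans eq (sym (distE-unique g db))))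
    ; full-generator = full-generatorᵉ
    ; resolves⇒generator = λ g S⊆V res → (λ s p → true∈ (S⊆V (mem p))) , λ v w v′ w′ p p′ ne →
        let s , sS , h = res (in-V p) (in-V p′) ne
        in s , true∈ sS , _ , _ , distE (S⊆V sS) p , distE (S⊆V sS) p′ , h
    }
    where
    in-V : ∀ {v w} → adj G v w ≡ true → Edge G V v w
    in-V p = edge p (mem (adj-vert G _ _ p)) (adj-vertʳ {H = G} p)
    distE : ∀ {s v w} → s ∈ V → adj G v w ≡ true → DistE G s v w (dᵉ s (v , w))
    distE sV p = _ , _ , dist sV (leftᵉ (in-V p)) , dist sV (rightᵉ (in-V p)) , refl

-- From `G [ vert G ]` to `G`, and from integers to naturals

IsCycle-spanning : ∀ {n} {G : Graph n} → IsCycle (G [ vert G ]) → IsCycle G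
IsCycle-spanning {G = G} (k , f , inj , on , onto , nbrs) = k , f , inj , on , onto , λ i j → mk⇔
  (λ p → Equivalence.to (nbrs i j) (edge⁺ {G = G} {vert G} (edge p (mem (on i)) (mem (on j)))))
  (λ q → adjᵉ (edge⁻ {G = G} {vert G} (Equivalence.from (nbrs i j) q)))

∣E∣-spanning : ∀ {n} (G : Graph n) → ∣E∣ (G [ vert G ]) ≡ ∣E∣ G
∣E∣-spanning G = sumF-cong λ u →
  countB-cong {A = λ v → adj (G [ vert G ]) u v ∧ (toℕ u <ᵇ toℕ v)} λ v → cong (_∧ (toℕ u <ᵇ toℕ v)) (same u v)
  where
  same : ∀ u v → adj (G [ vert G ]) u v ≡ adj G u v
  same u v with adj G u v in e
  ... | false = refl
  ... | true  = ∧-intro (adj-vert G u v e) (true∈ (adj-vertʳ {H = G} e))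

open import Data.Integer using (+_; _-_) renaming (_≤_ to _≤ℤ_; _*_ to _*ℤ_; _+_ to _+ℤ_)

module _ {n} (H : Graph n) {k : ℕ} where

  private
    v = ∣V∣ H
    e = ∣E∣ H

  -- Adding 2|V| to both sides clears the subtractions.
  cyc-bound⇒ℕ-bound : + k ≤ℤ + 2 *ℤ cyc H - + 1 → k + 2 * ∣V∣ H ≤ 2 * ∣E∣ H + 1
  cyc-bound⇒ℕ-bound h = ℤ.drop‿+≤+ (subst₂ _≤ℤ_ lhs rhs (ℤ.+-monoˡ-≤ (+ 2 *ℤ + v) h))
    where
    lhs : + k +ℤ + 2 *ℤ + v ≡ + (k + 2 * v)
    lhs = trans (cong (+ k +ℤ_) (sym (ℤ.pos-* 2 v))) (sym (ℤ.pos-+ k (2 * v)))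
    ring : ∀ e v → + 2 *ℤ (e - v +ℤ + 1) - + 1 +ℤ + 2 *ℤ v ≡ + 2 *ℤ e +ℤ + 1
    ring = ℤ.solve-∀
    rhs : + 2 *ℤ cyc H - + 1 +ℤ + 2 *ℤ + v ≡ + (2 * e + 1)
    rhs = trans (ring (+ e) (+ v)) (trans (cong (_+ℤ + 1) (sym (ℤ.pos-* 2 e))) (sym (ℤ.pos-+ (2 * e) 1)))

  ℕ-bound⇒cyc-bound : k + 2 * ∣V∣ H ≤ 2 * ∣E∣ H + 1 → + k ≤ℤ + 2 *ℤ cyc H - + 1
  ℕ-bound⇒cyc-bound h = subst₂ _≤ℤ_ lhs rhs (ℤ.+-monoˡ-≤ -2v (ℤ.+≤+ h))
    where
    -2v = ℤ.- (+ 2 *ℤ + v)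
    cancel : ∀ k v → k +ℤ + 2 *ℤ v +ℤ ℤ.- (+ 2 *ℤ v) ≡ k
    cancel = ℤ.solve-∀
    lhs : + (k + 2 * v) +ℤ -2v ≡ + k
    lhs = trans (cong (_+ℤ -2v) (trans (ℤ.pos-+ k (2 * v)) (cong (+ k +ℤ_) (ℤ.pos-* 2 v)))) (cancel (+ k) (+ v))
    ring : ∀ e v → + 2 *ℤ e +ℤ + 1 +ℤ ℤ.- (+ 2 *ℤ v) ≡ + 2 *ℤ (e - v +ℤ + 1) - + 1
    ring = ℤ.solve-∀
    rhs : + (2 * e + 1) +ℤ -2v ≡ + 2 *ℤ cyc H - + 1
    rhs = trans (cong (_+ℤ -2v) (trans (ℤ.pos-+ (2 * e) 1) (cong (_+ℤ + 1) (ℤ.pos-* 2 e)))) (ring (+ e) (+ v))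

-- The distance function and the final bound

Distance : ∀ {n} → Graph n → Set
Distance {n} G = Σ (Fin n → Fin n → ℕ) λ d → ∀ {u v} → u ∈ vert G → v ∈ vert G → Dist G u v (d u v)

distance : ∀ {n} {G : Graph n} → Connected G → ¬ ¬ Distance G
distance {n} {G} conn = do
  D ← ¬¬-finite-choice λ u → ¬¬-finite-choice λ v → choose u v
  return ((λ u v → proj₁ (D u v)) , λ {u} {v} p q → proj₂ (D u v) p q)
  where
  choose : ∀ u v → ¬ ¬ (∃[ k ] (u ∈ vert G → v ∈ vert G → Dist G u v k))
  choose u v with u ∈? vert G | v ∈? vert G
  -- Outside the vertex set, 0 is a default value.
  ... | no ¬p | _     = return (0 , λ p _ → contradiction p ¬p)
  ... | yes _ | no ¬q = return (0 , λ _ q → contradiction q ¬q)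
  ... | yes p | yes q = do
    k , walk , min ← least (λ k → k) (proj₂ (conn u v (true∈ p) (true∈ q)))
    return (k , λ _ _ → walk , min)

module _ {n} {G : Graph n} {d : Fin n → Fin n → ℕ} {dist : ∀ {u v} → u ∈ vert G → v ∈ vert G → Dist G u v (d u v)}
         (conn : Connected G) (deg≥2 : MinDegree≥2 G) (¬cyc : ¬ IsCycle G) where

  open Metric G d dist
  open Landmarks G d dist
  open Construction G d dist

  minimum-bound : (𝒪 : Objects) → BlockBound 𝒪 → ∀ {k} → IsMinimum 𝒪 G k → ¬ ¬ (k + 2 * ∣V∣ G ≤ 2 * ∣E∣ G + 1)
  minimum-bound 𝒪 bound {k} (_ , min) = do
    unrooted S S⊆V size resolves ← small
    return (≤-trans (+-monoˡ-≤ (2 * ∣V∣ G) (min S (resolves⇒generator g S⊆V resolves)))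
                    (subst (λ e → countB S + 2 * ∣V∣ G ≤ 2 * e + 1) (∣E∣-spanning G) size))
    where
    open Objects 𝒪
    g : Good V
    g = good-V conn
    nbrs : ∀ {u} → u ∈ V → TwoNeighbours G V u
    nbrs {u} uV = let a , b , mem p , mem q , ne = countB-pair (deg≥2 u (true∈ uV)) in
      a , b , edge p uV (adj-vertʳ {H = G} p) , edge q uV (adj-vertʳ {H = G} q) , ne
    small : ¬ ¬ Unrooted 𝒪 V
    small with any? (_∈? V)
    ... | yes (u , uV) = unrooted-V 𝒪 bound g nbrs uV (¬cyc ∘ IsCycle-spanning {G = G})
    ... | no empty = return (unrooted ∅ (λ { (mem ()) }) zero-size (λ i → contradiction (inhabited i) empty))
      where
      zero-size : countB {n} ∅ + 2 * countB V ≤ 2 * ∣E∣ (G [ V ]) + 1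
      zero-size rewrite countB-∅ {n} | n≤0⇒n≡0 (subst (countB V ≤_) (countB-∅ {n})
        (countB-mono {A = V} {∅} (λ p → contradiction (_ , p) empty))) = z≤n

theorem10 : ∀ {n} (G : Graph n) → Connected G → MinDegree≥2 G → ¬ IsCycle G →
    ((∀ H → NontrivialBlock G H → ¬ IsCycle H →
    ∀ d → IsDim H d → + d ≤ℤ + 2 *ℤ cyc H - + 1) →
    ∀ d → IsDim G d → + d ≤ℤ + 2 *ℤ cyc G - + 1)
    × ((∀ H → NontrivialBlock G H → ¬ IsCycle H →
    ∀ d → IsEdim H d → + d ≤ℤ + 2 *ℤ cyc H - + 1) →
    ∀ d → IsEdim G d → + d ≤ℤ + 2 *ℤ cyc G - + 1)
theorem10 G conn deg≥2 ¬cyc =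
  (λ hyp k min → ℕ-bound⇒cyc-bound G (decidable-stable (_ ℕ.≤? _) (do
     d , dist ← distance conn
     minimum-bound conn deg≥2 ¬cyc (Instances.vertices G d dist)
       (λ H b c k m → cyc-bound⇒ℕ-bound H (hyp H b c k m)) min))) ,
  (λ hyp k min → ℕ-bound⇒cyc-bound G (decidable-stable (_ ℕ.≤? _) (do
     d , dist ← distance conn
     minimum-bound conn deg≥2 ¬cyc (Instances.edges G d dist)
       (λ H b c k m → cyc-bound⇒ℕ-bound H (hyp H b c k m)) min)))
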